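{- There is a constant $C$ such that every unit distance graph on a convexly independent set of $n\ge2$ points in the plane has at most $2n\log_2 n + Cn$ edges.
   Context: A finite point set $P\subset\mathbb{R}^2$ is convexly independent if no point of $P$ lies in the convex hull of the other points. The unit distance graph on $P$ has vertex set $P$, with $p,q$ adjacent if and only if $|pq|=1$. -}

module Defs where

open import Data.Fin using (Fin)
import Data.Fin as Fin
open import Data.Integer using (+_)
import Data.Integer as ℤ
import Data.Integer.Properties as ℤ
open import Data.List using (List; length)
open import Data.List.Relation.Unary.All using (All)
open import Data.List.Relation.Unary.Unique.Propositional using (Unique)
open import Data.Nat using (ℕ; zero; suc; z≤n; s≤s; ⌊_/2⌋)
import Data.Nat as ℕ
import Data.Nat.Properties as ℕ
open import Data.Nat.Induction using (<-wellFounded)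
open import Data.Nat.Logarithm using (⌊log₂_⌋; ⌊log₂⌋-mono-≤; ⌊log₂[2^n]⌋≡n)
open import Data.Nat.Logarithm.Core using (⌊log2⌋)
open import Data.Product using (Σ-syntax; ∃-syntax; _×_; _,_; proj₁; proj₂)
open import Data.Rational using (ℚ; 0ℚ; 1ℚ; ½; _/_; ∣_∣)
import Data.Rational as ℚ
import Data.Rational.Properties as ℚ
open import Data.Rational.Solver using (module +-*-Solver)
import Data.Rational.Unnormalised as ℚᵘ
import Data.Rational.Unnormalised.Properties as ℚᵘ
open import Data.Sum using (inj₁; inj₂)
open import Data.Vec.Functional using (Vector; foldr)
open import Induction.WellFounded using (Acc; acc)
open import Relation.Binary.Definitions using (Symmetric; Irreflexive)
open import Relation.Binary.PropositionalEquality using (_≡_; refl; sym; trans; cong; cong₂; subst; subst₂)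
open import Relation.Nullary using (¬_; yes; no; contradiction)

-- Real numbers are Cauchy sequences of rationals, with _≈_ as equality.

IsCauchy : (ℕ → ℚ) → Set
IsCauchy s = ∀ ε → 0ℚ ℚ.< ε →
  ∃[ N ] (∀ m n → N ℕ.≤ m → N ℕ.≤ n → ∣ s m ℚ.- s n ∣ ℚ.< ε)

record ℝ : Set where
  constructor mkℝ
  field
    seq    : ℕ → ℚ
    cauchy : IsCauchy seq

open ℝ public

infix 4 _≈_ _≤_

_≈_ : ℝ → ℝ → Set
x ≈ y = ∀ ε → 0ℚ ℚ.< ε →
  ∃[ N ] (∀ n → N ℕ.≤ n → ∣ seq x n ℚ.- seq y n ∣ ℚ.< ε)

_≤_ : ℝ → ℝ → Set
x ≤ y = ∀ ε → 0ℚ ℚ.< ε →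
  ∃[ N ] (∀ n → N ℕ.≤ n → seq x n ℚ.< seq y n ℚ.+ ε)

module CauchyLemmas where
  half-pos : ∀ {ε} → 0ℚ ℚ.< ε → 0ℚ ℚ.< ½ ℚ.* ε
  half-pos {ε} 0<ε = subst (ℚ._< ½ ℚ.* ε) (ℚ.*-zeroʳ ½) (ℚ.*-monoʳ-<-pos ½ 0<ε)

  half+half : ∀ ε → ½ ℚ.* ε ℚ.+ ½ ℚ.* ε ≡ ε
  half+half ε = trans (sym (ℚ.*-distribʳ-+ ε ½ ½)) (ℚ.*-identityˡ ε)

  const-cauchy : ∀ q → IsCauchy (λ _ → q)
  const-cauchy q ε 0<ε = 0 , λ _ _ _ _ →
    subst (λ r → ∣ r ∣ ℚ.< ε) (sym (ℚ.+-inverseʳ q)) 0<ε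

  neg-cauchy : ∀ s → IsCauchy s → IsCauchy (λ n → ℚ.- s n)
  neg-cauchy s cs ε 0<ε with cs ε 0<ε
  ... | N , p = N , λ m n N≤m N≤n →
    subst (ℚ._< ε)
      (trans (sym (ℚ.∣-p∣≡∣p∣ (s m ℚ.- s n)))
             (cong ∣_∣ (ℚ.neg-distrib-+ (s m) (ℚ.- s n))))
      (p m n N≤m N≤n)

  +-rearrange : ∀ a b c d → (a ℚ.- b) ℚ.+ (c ℚ.- d) ≡ (a ℚ.+ c) ℚ.- (b ℚ.+ d)
  +-rearrange = solve 4
    (λ a b c d → (a :+ :- b) :+ (c :+ :- d) := (a :+ c) :+ :- (b :+ d)) refl
    where open +-*-Solver

  *-rearrange : ∀ a b c d →
    a ℚ.* (c ℚ.- d) ℚ.+ d ℚ.* (a ℚ.- b) ≡ a ℚ.* c ℚ.- b ℚ.* d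
  *-rearrange = solve 4
    (λ a b c d → a :* (c :+ :- d) :+ d :* (a :+ :- b) := a :* c :+ :- (b :* d)) refl
    where open +-*-Solver

  +-cauchy : ∀ s t → IsCauchy s → IsCauchy t → IsCauchy (λ n → s n ℚ.+ t n)
  +-cauchy s t cs ct ε 0<ε with cs (½ ℚ.* ε) (half-pos 0<ε) | ct (½ ℚ.* ε) (half-pos 0<ε)
  ... | M , p | N , q = M ℕ.⊔ N , λ m n l l′ →
    subst₂ ℚ._<_ (cong ∣_∣ (+-rearrange (s m) (s n) (t m) (t n))) (half+half ε)
      (ℚ.≤-<-trans (ℚ.∣p+q∣≤∣p∣+∣q∣ (s m ℚ.- s n) (t m ℚ.- t n))
        (ℚ.+-mono-< (p m n (ℕ.m⊔n≤o⇒m≤o M N l) (ℕ.m⊔n≤o⇒m≤o M N l′))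
                    (q m n (ℕ.m⊔n≤o⇒n≤o M N l) (ℕ.m⊔n≤o⇒n≤o M N l′))))

  eventually-bounded : ∀ s → IsCauchy s →
    ∃[ B ] ∃[ N ] (0ℚ ℚ.< B × (∀ n → N ℕ.≤ n → ∣ s n ∣ ℚ.≤ B))
  eventually-bounded s cs with cs 1ℚ (ℚ.positive⁻¹ 1ℚ)
  ... | N , p = 1ℚ ℚ.+ ∣ s N ∣ , N , pos , bound
    where
    pos : 0ℚ ℚ.< 1ℚ ℚ.+ ∣ s N ∣
    pos = ℚ.+-mono-<-≤ (ℚ.positive⁻¹ 1ℚ) (ℚ.0≤∣p∣ (s N))

    cancel : ∀ a b → (a ℚ.- b) ℚ.+ b ≡ a
    cancel = solve 2 (λ a b → (a :+ :- b) :+ b := a) refl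
      where open +-*-Solver

    bound : ∀ n → N ℕ.≤ n → ∣ s n ∣ ℚ.≤ 1ℚ ℚ.+ ∣ s N ∣
    bound n N≤n = subst (λ r → ∣ r ∣ ℚ.≤ 1ℚ ℚ.+ ∣ s N ∣) (cancel (s n) (s N))
      (ℚ.≤-trans (ℚ.∣p+q∣≤∣p∣+∣q∣ (s n ℚ.- s N) (s N))
        (ℚ.+-monoˡ-≤ ∣ s N ∣ (ℚ.<⇒≤ (p n N N≤n ℕ.≤-refl))))

  quotient : ∀ B ε → 0ℚ ℚ.< B → 0ℚ ℚ.< ε → ∃[ δ ] (0ℚ ℚ.< δ × B ℚ.* δ ≡ ε)
  quotient B ε 0<B 0<ε = ℚ.1/ B ℚ.* ε
    , subst (ℚ._< ℚ.1/ B ℚ.* ε) (ℚ.*-zeroʳ (ℚ.1/ B))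
        (ℚ.*-monoʳ-<-pos (ℚ.1/ B) {{ℚ.1/pos⇒pos B}} 0<ε)
    , trans (sym (ℚ.*-assoc B (ℚ.1/ B) ε))
        (trans (cong (ℚ._* ε) (ℚ.*-inverseʳ B)) (ℚ.*-identityˡ ε))
    where
    instance
      B-pos : ℚ.Positive B
      B-pos = ℚ.positive 0<B
      B-nonZero : ℚ.NonZero B
      B-nonZero = ℚ.pos⇒nonZero B

  ∣*∣-< : ∀ a b {A δ} → 0ℚ ℚ.< A → ∣ a ∣ ℚ.≤ A → ∣ b ∣ ℚ.< δ → ∣ a ℚ.* b ∣ ℚ.< A ℚ.* δ
  ∣*∣-< a b {A} {δ} 0<A a≤A b<δ = subst (ℚ._< A ℚ.* δ) (sym (ℚ.∣p*q∣≡∣p∣*∣q∣ a b))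
    (ℚ.≤-<-trans
      (ℚ.*-monoʳ-≤-nonNeg ∣ b ∣ {{ℚ.∣-∣-nonNeg b}} a≤A)
      (ℚ.*-monoʳ-<-pos A {{ℚ.positive 0<A}} b<δ))

  *-cauchy : ∀ s t → IsCauchy s → IsCauchy t → IsCauchy (λ n → s n ℚ.* t n)
  *-cauchy s t cs ct ε 0<ε =
    let A , K , 0<A , s≤A = eventually-bounded s cs
        B , L , 0<B , t≤B = eventually-bounded t ct
        α , 0<α , Aα≡     = quotient A (½ ℚ.* ε) 0<A (half-pos 0<ε)
        β , 0<β , Bβ≡     = quotient B (½ ℚ.* ε) 0<B (half-pos 0<ε)
        M , p             = cs β 0<β
        N , q             = ct α 0<α
    in (K ℕ.⊔ L) ℕ.⊔ (M ℕ.⊔ N) , λ m n l l′ →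
      let kl  = ℕ.m⊔n≤o⇒m≤o (K ℕ.⊔ L) (M ℕ.⊔ N) l
          kl′ = ℕ.m⊔n≤o⇒m≤o (K ℕ.⊔ L) (M ℕ.⊔ N) l′
          mn  = ℕ.m⊔n≤o⇒n≤o (K ℕ.⊔ L) (M ℕ.⊔ N) l
          mn′ = ℕ.m⊔n≤o⇒n≤o (K ℕ.⊔ L) (M ℕ.⊔ N) l′
      in *-close (s m) (s n) (t m) (t n) 0<A 0<B Aα≡ Bβ≡
           (s≤A m (ℕ.m⊔n≤o⇒m≤o K L kl)) (t≤B n (ℕ.m⊔n≤o⇒n≤o K L kl′))
           (p m n (ℕ.m⊔n≤o⇒m≤o M N mn) (ℕ.m⊔n≤o⇒m≤o M N mn′))
           (q m n (ℕ.m⊔n≤o⇒n≤o M N mn) (ℕ.m⊔n≤o⇒n≤o M N mn′))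
    where
    *-close : ∀ a b c d {A B α β} → 0ℚ ℚ.< A → 0ℚ ℚ.< B →
      A ℚ.* α ≡ ½ ℚ.* ε → B ℚ.* β ≡ ½ ℚ.* ε →
      ∣ a ∣ ℚ.≤ A → ∣ d ∣ ℚ.≤ B → ∣ a ℚ.- b ∣ ℚ.< β → ∣ c ℚ.- d ∣ ℚ.< α →
      ∣ a ℚ.* c ℚ.- b ℚ.* d ∣ ℚ.< ε
    *-close a b c d 0<A 0<B Aα≡ Bβ≡ a≤A d≤B a-b<β c-d<α =
      subst₂ ℚ._<_ (cong ∣_∣ (*-rearrange a b c d))
        (trans (cong₂ ℚ._+_ Aα≡ Bβ≡) (half+half ε))
        (ℚ.≤-<-trans (ℚ.∣p+q∣≤∣p∣+∣q∣ (a ℚ.* (c ℚ.- d)) (d ℚ.* (a ℚ.- b)))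
          (ℚ.+-mono-< (∣*∣-< a (c ℚ.- d) 0<A a≤A c-d<α)
                      (∣*∣-< d (a ℚ.- b) 0<B d≤B a-b<β)))

open CauchyLemmas

fromℚ : ℚ → ℝ
fromℚ q = mkℝ (λ _ → q) (const-cauchy q)

fromℕ : ℕ → ℝ
fromℕ n = fromℚ (+ n / 1)

0ℝ 1ℝ : ℝ
0ℝ = fromℚ 0ℚ
1ℝ = fromℚ 1ℚ

infix  8 -_
infixl 7 _*_
infixl 6 _+_ _-_

_+_ : ℝ → ℝ → ℝ
x + y = mkℝ (λ n → seq x n ℚ.+ seq y n) (+-cauchy (seq x) (seq y) (cauchy x) (cauchy y))

_*_ : ℝ → ℝ → ℝ
x * y = mkℝ (λ n → seq x n ℚ.* seq y n) (*-cauchy (seq x) (seq y) (cauchy x) (cauchy y))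

-_ : ℝ → ℝ
- x = mkℝ (λ n → ℚ.- seq x n) (neg-cauchy (seq x) (cauchy x))

_-_ : ℝ → ℝ → ℝ
x - y = x + (- y)

sum : ∀ {k} → Vector ℝ k → ℝ
sum = foldr _+_ 0ℝ

-- With p = ⌊log₂ n ^ a⌋ one has 2 ^ p ≤ n ^ a < 2 ^ (p + 1), so that p / a
-- approximates log₂ n from below with error less than 1 / a.
log₂-approx : ℕ → ℕ → ℚ
log₂-approx n k = + ⌊log₂ n ℕ.^ suc k ⌋ / suc k

module LogLemmas where
  2*⌊n/2⌋≤n : ∀ n → 2 ℕ.* ⌊ n /2⌋ ℕ.≤ n
  2*⌊n/2⌋≤n zero = z≤n
  2*⌊n/2⌋≤n (suc zero) = z≤n
  2*⌊n/2⌋≤n (suc (suc n)) =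
    subst (ℕ._≤ suc (suc n)) (sym (ℕ.*-suc 2 ⌊ n /2⌋)) (s≤s (s≤s (2*⌊n/2⌋≤n n)))

  2^⌊log2⌋≤n : ∀ n .{{_ : ℕ.NonZero n}} (a : Acc ℕ._<_ n) → 2 ℕ.^ ⌊log2⌋ n a ℕ.≤ n
  2^⌊log2⌋≤n (suc zero)    _        = ℕ.≤-refl
  2^⌊log2⌋≤n (suc (suc n)) (acc rs) = ℕ.≤-trans
    (ℕ.*-monoʳ-≤ 2 (2^⌊log2⌋≤n (suc ⌊ n /2⌋) (rs _)))
    (2*⌊n/2⌋≤n (suc (suc n)))

  2^⌊log₂⌋≤n : ∀ n .{{_ : ℕ.NonZero n}} → 2 ℕ.^ ⌊log₂ n ⌋ ℕ.≤ n
  2^⌊log₂⌋≤n n = 2^⌊log2⌋≤n n (<-wellFounded n)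

  n<2^[1+⌊log₂⌋] : ∀ n → n ℕ.< 2 ℕ.^ suc ⌊log₂ n ⌋
  n<2^[1+⌊log₂⌋] n with 2 ℕ.^ suc ⌊log₂ n ⌋ ℕ.≤? n
  ... | no ¬p = ℕ.≰⇒> ¬p
  ... | yes p = contradiction
    (subst (ℕ._≤ ⌊log₂ n ⌋) (⌊log₂[2^n]⌋≡n (suc ⌊log₂ n ⌋)) (⌊log₂⌋-mono-≤ p))
    ℕ.1+n≰n

  2^-cancel-≤ : ∀ {i j} → 2 ℕ.^ i ℕ.≤ 2 ℕ.^ j → i ℕ.≤ j
  2^-cancel-≤ {i} {j} p with i ℕ.≤? j
  ... | yes i≤j = i≤j
  ... | no  i≰j = contradiction p
    (ℕ.<⇒≱ (ℕ.^-monoʳ-< 2 (s≤s (s≤s z≤n)) (ℕ.≰⇒> i≰j)))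

  -- ⌊log₂ nᵃ⌋ / a ≤ (⌊log₂ nᵇ⌋ + 1) / b
  cross : ∀ n .{{_ : ℕ.NonZero n}} a b →
    ⌊log₂ n ℕ.^ a ⌋ ℕ.* b ℕ.≤ suc ⌊log₂ n ℕ.^ b ⌋ ℕ.* a
  cross n a b = 2^-cancel-≤ (begin
    2 ℕ.^ (p ℕ.* b)       ≡⟨ ℕ.^-*-assoc 2 p b ⟨
    (2 ℕ.^ p) ℕ.^ b       ≤⟨ ℕ.^-monoˡ-≤ b (2^⌊log₂⌋≤n (n ℕ.^ a) {{ℕ.m^n≢0 n a}}) ⟩
    (n ℕ.^ a) ℕ.^ b       ≡⟨ ℕ.^-*-assoc n a b ⟩
    n ℕ.^ (a ℕ.* b)       ≡⟨ cong (n ℕ.^_) (ℕ.*-comm a b) ⟩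
    n ℕ.^ (b ℕ.* a)       ≡⟨ ℕ.^-*-assoc n b a ⟨
    (n ℕ.^ b) ℕ.^ a       ≤⟨ ℕ.^-monoˡ-≤ a (ℕ.<⇒≤ (n<2^[1+⌊log₂⌋] (n ℕ.^ b))) ⟩
    (2 ℕ.^ suc q) ℕ.^ a   ≡⟨ ℕ.^-*-assoc 2 (suc q) a ⟩
    2 ℕ.^ (suc q ℕ.* a)   ∎)
    where
    open ℕ.≤-Reasoning
    p = ⌊log₂ n ℕ.^ a ⌋
    q = ⌊log₂ n ℕ.^ b ⌋

  /-mono : ∀ p a q b → p ℕ.* suc b ℕ.≤ q ℕ.* suc a → + p / suc a ℚ.≤ + q / suc b
  /-mono p a q b le = ℚ.toℚᵘ-cancel-≤
    (ℚᵘ.≤-respˡ-≃ (ℚᵘ.≃-sym (ℚ.toℚᵘ-fromℚᵘ (ℚᵘ.mkℚᵘ (+ p) a)))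
    (ℚᵘ.≤-respʳ-≃ (ℚᵘ.≃-sym (ℚ.toℚᵘ-fromℚᵘ (ℚᵘ.mkℚᵘ (+ q) b)))
    (ℚᵘ.*≤* (subst₂ ℤ._≤_ (ℤ.pos-* p (suc b)) (ℤ.pos-* q (suc a)) (ℤ.+≤+ le)))))

  suc-/ : ∀ q b → + suc q / suc b ≡ + q / suc b ℚ.+ + 1 / suc b
  suc-/ q b = ℚ.toℚᵘ-injective
    (ℚᵘ.≃-trans (ℚ.toℚᵘ-fromℚᵘ (ℚᵘ.mkℚᵘ (+ suc q) b))
    (ℚᵘ.≃-trans eq
    (ℚᵘ.≃-sym (ℚᵘ.≃-trans (ℚ.toℚᵘ-homo-+ (+ q / suc b) (+ 1 / suc b))
      (ℚᵘ.+-cong (ℚ.toℚᵘ-fromℚᵘ (ℚᵘ.mkℚᵘ (+ q) b)) (ℚ.toℚᵘ-fromℚᵘ (ℚᵘ.mkℚᵘ (+ 1) b)))))))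
    where
    eq : ℚᵘ.mkℚᵘ (+ suc q) b ℚᵘ.≃ ℚᵘ.mkℚᵘ (+ q) b ℚᵘ.+ ℚᵘ.mkℚᵘ (+ 1) b
    eq = ℚᵘ.*≡* (trans (cong (ℤ._* (d ℤ.* d)) (ℤ.+-comm (+ 1) (+ q)))
      (trans (sym (ℤ.*-assoc (+ q ℤ.+ + 1) d d))
        (cong (ℤ._* d) (ℤ.*-distribʳ-+ d (+ q) (+ 1)))))
      where d = + suc b

  archimedean : ∀ ε → 0ℚ ℚ.< ε → ∃[ N ] (∀ n → N ℕ.≤ n → + 1 / suc n ℚ.< ε)
  archimedean ε 0<ε with ε | ℚ.positive 0<ε
  ... | ℚ.mkℚ (+ suc m) d c | _ = suc d , λ n d<n → ℚ.toℚᵘ-cancel-<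
    (ℚᵘ.<-respˡ-≃ (ℚᵘ.≃-sym (ℚ.toℚᵘ-fromℚᵘ (ℚᵘ.mkℚᵘ (+ 1) n)))
      (ℚᵘ.*<* (subst (ℤ._< + suc m ℤ.* + suc n) (sym (ℤ.*-identityˡ (+ suc d)))
        (ℤ.+<+ (ℕ.≤-trans (s≤s d<n) (ℕ.m≤m+n (suc n) (m ℕ.* suc n)))))))

  ∣∣-< : ∀ u v {ε} → u ℚ.< v ℚ.+ ε → v ℚ.< u ℚ.+ ε → ∣ u ℚ.- v ∣ ℚ.< ε
  ∣∣-< u v {ε} u<v+ε v<u+ε with ℚ.∣p∣≡p∨∣p∣≡-p (u ℚ.- v)
  ... | inj₁ eq = subst₂ ℚ._<_ (sym eq) (cancel v ε) (ℚ.+-monoˡ-< (ℚ.- v) u<v+ε)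
    where
    open +-*-Solver
    cancel : ∀ a b → (a ℚ.+ b) ℚ.- a ≡ b
    cancel = solve 2 (λ a b → (a :+ b) :+ :- a := b) refl
  ... | inj₂ eq = subst₂ ℚ._<_ (trans (flip u v) (sym eq)) (cancel u ε) (ℚ.+-monoˡ-< (ℚ.- u) v<u+ε)
    where
    open +-*-Solver
    cancel : ∀ a b → (a ℚ.+ b) ℚ.- a ≡ b
    cancel = solve 2 (λ a b → (a :+ b) :+ :- a := b) refl
    flip : ∀ a b → b ℚ.- a ≡ ℚ.- (a ℚ.- b)
    flip = solve 2 (λ a b → b :+ :- a := :- (a :+ :- b)) refl

  log₂-approx-cauchy : ∀ n .{{_ : ℕ.NonZero n}} → IsCauchy (log₂-approx n)
  log₂-approx-cauchy n ε 0<ε with archimedean ε 0<ε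
  ... | N , small = N , λ i j N≤i N≤j →
    ∣∣-< (log₂-approx n i) (log₂-approx n j) (close i j N≤j) (close j i N≤i)
    where
    close : ∀ i j → N ℕ.≤ j → log₂-approx n i ℚ.< log₂-approx n j ℚ.+ ε
    close i j N≤j = ℚ.≤-<-trans
      (subst (log₂-approx n i ℚ.≤_) (suc-/ ⌊log₂ n ℕ.^ suc j ⌋ j)
        (/-mono ⌊log₂ n ℕ.^ suc i ⌋ i (suc ⌊log₂ n ℕ.^ suc j ⌋) j (cross n (suc i) (suc j))))
      (ℚ.+-monoʳ-< (log₂-approx n j) (small j N≤j))

open LogLemmas

-- The value at 0 is a dummy.
log₂ : ℕ → ℝ
log₂ zero      = 0ℝ
log₂ n@(suc _) = mkℝ (log₂-approx n) (log₂-approx-cauchy n)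

Point : Set
Point = ℝ × ℝ

infix 4 _≈ₚ_

_≈ₚ_ : Point → Point → Set
(x , y) ≈ₚ (x′ , y′) = x ≈ x′ × y ≈ y′

-- d = |pq|, i.e. d is the non-negative square root of (x - x′)² + (y - y′)².
IsDistance : Point → Point → ℝ → Set
IsDistance (x , y) (x′ , y′) d =
  0ℝ ≤ d × d * d ≈ (x - x′) * (x - x′) + (y - y′) * (y - y′)

ConvexHull : (Point → Set) → Point → Set
ConvexHull S p =
  ∃[ k ] Σ[ w ∈ Vector ℝ k ] Σ[ q ∈ Vector Point k ]
    (∀ i → S (q i)) ×
    (∀ i → 0ℝ ≤ w i) ×
    sum w ≈ 1ℝ ×
    p ≈ₚ (sum (λ i → w i * proj₁ (q i)) , sum (λ i → w i * proj₂ (q i)))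

record PointSet (n : ℕ) : Set where
  field
    point    : Fin n → Point
    distinct : ∀ {i j} → point i ≈ₚ point j → i ≡ j

open PointSet public

infix 4 _∈_

_∈_ : ∀ {n} → Point → PointSet n → Set
p ∈ P = ∃[ i ] p ≈ₚ point P i

ConvexlyIndependent : ∀ {n} → PointSet n → Set
ConvexlyIndependent P =
  ∀ p → p ∈ P → ¬ ConvexHull (λ q → q ∈ P × ¬ q ≈ₚ p) p

record SimpleGraph (V : Set) : Set₁ where
  field
    Adjacent    : V → V → Set
    symmetric   : Symmetric Adjacent
    irreflexive : Irreflexive _≡_ Adjacent

open SimpleGraph public

-- An undirected edge {i , j} is represented by the pair (i , j) with i < j.
IsEdge : ∀ {n} → SimpleGraph (Fin n) → Fin n × Fin n → Set
IsEdge G (i , j) = i Fin.< j × Adjacent G i j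

-- Adjacency need not be decidable, so the edges cannot be counted by a
-- function; the edge set has at most b elements when no list of pairwise
-- distinct edges is longer than b.
HasAtMostEdges : ∀ {n} → SimpleGraph (Fin n) → ℝ → Set
HasAtMostEdges {n} G b =
  (es : List (Fin n × Fin n)) → Unique es → All (IsEdge G) es → fromℕ (length es) ≤ b

module DistanceLemmas where
  IsDistance-sym : ∀ p q d → IsDistance p q d → IsDistance q p d
  IsDistance-sym (x , y) (x′ , y′) d (0≤d , eq) = 0≤d , λ ε 0<ε →
    let N , f = eq ε 0<ε in N , λ n N≤n →
      subst (λ r → ∣ seq (d * d) n ℚ.- r ∣ ℚ.< ε)
        (swap (seq x n) (seq x′ n) (seq y n) (seq y′ n)) (f n N≤n)
    where
    open +-*-Solver
    swap : ∀ a b c e →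
      (a ℚ.- b) ℚ.* (a ℚ.- b) ℚ.+ (c ℚ.- e) ℚ.* (c ℚ.- e) ≡
      (b ℚ.- a) ℚ.* (b ℚ.- a) ℚ.+ (e ℚ.- c) ℚ.* (e ℚ.- c)
    swap = solve 4 (λ a b c e →
      (a :+ :- b) :* (a :+ :- b) :+ (c :+ :- e) :* (c :+ :- e) :=
      (b :+ :- a) :* (b :+ :- a) :+ (e :+ :- c) :* (e :+ :- c)) refl

  ¬IsDistance-self : ∀ p → ¬ IsDistance p p 1ℝ
  ¬IsDistance-self (x , y) (_ , eq) with eq 1ℚ (ℚ.positive⁻¹ 1ℚ)
  ... | N , f = ℚ.<-irrefl {1ℚ} refl
    (subst₂ (λ a b → ∣ 1ℚ ℚ.- (a ℚ.* a ℚ.+ b ℚ.* b) ∣ ℚ.< 1ℚ)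
      (ℚ.+-inverseʳ (seq x N)) (ℚ.+-inverseʳ (seq y N)) (f N ℕ.≤-refl))

open DistanceLemmas

unitDistanceGraph : ∀ {n} → PointSet n → SimpleGraph (Fin n)
unitDistanceGraph P = record
  { Adjacent    = λ i j → IsDistance (point P i) (point P j) 1ℝ
  ; symmetric   = λ {i} {j} → IsDistance-sym (point P i) (point P j) 1ℝ
  ; irreflexive = λ { {i} refl → ¬IsDistance-self (point P i) }
  }

{-# OPTIONS --safe #-}
-- Number the points in convex position cyclically. If |pb| = |qb| = |qc| = 1
-- with p < q < b < c in cyclic order, then the isosceles triangles p b q and b q c
-- have acute base angles at q and b. A convex quadrilateral does not have four
-- acute angles, so a unit edge {p , d} cannot have such a path on both of its
-- sides, and it can be directed from p to d so that no such path lies on the arc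
-- from p to d. Then arcs p → b, p → d, q → b, q → c with p < q < b < c < d do not
-- occur together.
--
-- Let δ be the cyclic distance. An arc p → b that is not the longest one p → l
-- from p is "far" if some arc p → c has b < c and 2 δ(b , c) ≤ δ(b , l). In the
-- order of their tails the values δ(b , c) of the far arcs into b at least double,
-- so far arcs are determined by b and ⌊log₂ δ(b , c)⌋. For the other arcs out of p
-- the values δ(b , l) are more than halved each time, so those are determined by p and
-- ⌊log₂ δ(b , l)⌋. This gives 2n(1 + ⌊log₂ n⌋) + n arcs at most.
module Submission where

open import Data.Bool using (if_then_else_)
open import Data.Empty using (⊥; ⊥-elim)
open import Data.Fin using (Fin; zero; suc; fromℕ<)
import Data.Fin as Fin
import Data.Fin.Properties as Fin
import Data.Integer as ℤ
import Data.Integer.Properties as ℤ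
open import Data.List using (List; length; lookup)
open import Data.List.Membership.Propositional.Properties using (∈-lookup)
open import Data.List.Relation.Unary.All using (All)
import Data.List.Relation.Unary.All as All
open import Data.List.Relation.Unary.Unique.Propositional using (Unique)
open import Data.Nat using (ℕ; zero; suc; _≥_; z≤n; s≤s)
import Data.Nat as ℕ
open import Data.Nat.Logarithm using (⌊log₂_⌋; ⌊log₂⌋-mono-≤; ⌊log₂[2*b]⌋≡1+⌊log₂b⌋; ⌊log₂[2^n]⌋≡n)
import Data.Nat.Properties as ℕ
open import Data.Nat.Tactic.RingSolver using (solve-∀)
open import Data.Product using (Σ-syntax; ∃-syntax; _×_; _,_; proj₁; proj₂)
open import Data.Product.Properties using (,-injective)
open import Data.Rational using (ℚ; 0ℚ; 1ℚ; ½; _/_; ∣_∣)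
import Data.Rational as ℚ
import Data.Rational.Properties as ℚ
open import Data.Rational.Solver using (module +-*-Solver)
import Data.Rational.Unnormalised as ℚᵘ
import Data.Rational.Unnormalised.Properties as ℚᵘ
open import Data.Sum using (_⊎_; inj₁; inj₂)
open import Data.Sum.Function.Propositional using (_⊎-↔_)
open import Data.Sum.Properties using (inj₁-injective; inj₂-injective)
open import Data.Unit using (tt)
open import Function using (_∘_)
open import Function.Bundles using (_↣_; module Injection)
open import Function.Properties.Inverse using (↔-refl; ↔-sym; ↔-trans; ↔⇒↣)
open import Relation.Binary.Definitions using (tri<; tri≈; tri>)
open import Relation.Binary.PropositionalEquality using (_≡_; _≢_; refl; sym; trans; cong; cong₂; subst; subst₂)
open import Relation.Nullary using (¬_; Dec; yes; no; does; contradiction; _×-dec_)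
open import Relation.Nullary.Decidable using (decidable-stable; ¬¬-excluded-middle)

-- Counting arcs on a cycle

module CyclicCombinatorics where
  open import Data.List.Relation.Unary.AllPairs using (_∷_)
  open import Data.Nat using (_+_; _*_; _∸_; _≤_; _<_; _≤?_; _<?_; >-nonZero)
  open import Data.Nat.Properties
  open import Data.Product using (swap)

  -- Counting decidable predicates, and maxima over finite types.

  count : ∀ {n} {Q : Fin n → Set} → (∀ i → Dec (Q i)) → ℕ
  count {zero}  Q? = 0
  count {suc n} Q? = (if does (Q? zero) then 1 else 0) + count (Q? ∘ suc)

  count≤n : ∀ {n} {Q : Fin n → Set} (Q? : ∀ i → Dec (Q i)) → count Q? ≤ n
  count≤n {zero}  Q? = z≤n
  count≤n {suc n} Q? with Q? zero
  ... | yes _ = s≤s (count≤n (Q? ∘ suc))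
  ... | no  _ = m≤n⇒m≤1+n (count≤n (Q? ∘ suc))

  count-mono : ∀ {n} {Q R : Fin n → Set} (Q? : ∀ i → Dec (Q i)) (R? : ∀ i → Dec (R i)) →
    (∀ i → Q i → R i) → count Q? ≤ count R?
  count-mono {zero}  Q? R? Q⊆R = z≤n
  count-mono {suc n} Q? R? Q⊆R with Q? zero | R? zero
  ... | yes q | yes r = s≤s (count-mono (Q? ∘ suc) (R? ∘ suc) (Q⊆R ∘ suc))
  ... | yes q | no ¬r = contradiction (Q⊆R zero q) ¬r
  ... | no ¬q | yes r = m≤n⇒m≤1+n (count-mono (Q? ∘ suc) (R? ∘ suc) (Q⊆R ∘ suc))
  ... | no ¬q | no ¬r = count-mono (Q? ∘ suc) (R? ∘ suc) (Q⊆R ∘ suc)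

  count-mono-< : ∀ {n} {Q R : Fin n → Set} (Q? : ∀ i → Dec (Q i)) (R? : ∀ i → Dec (R i)) →
    (∀ i → Q i → R i) → ∀ i → ¬ Q i → R i → count Q? < count R?
  count-mono-< {suc n} Q? R? Q⊆R zero ¬q r with Q? zero | R? zero
  ... | yes q | _     = contradiction q ¬q
  ... | no _  | yes _ = s≤s (count-mono (Q? ∘ suc) (R? ∘ suc) (Q⊆R ∘ suc))
  ... | no _  | no ¬r = contradiction r ¬r
  count-mono-< {suc n} Q? R? Q⊆R (suc i) ¬q r with Q? zero | R? zero
  ... | yes _ | yes _ = s≤s (count-mono-< (Q? ∘ suc) (R? ∘ suc) (Q⊆R ∘ suc) i ¬q r)
  ... | yes q | no ¬r = contradiction (Q⊆R zero q) ¬r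
  ... | no _  | yes _ = m≤n⇒m≤1+n (count-mono-< (Q? ∘ suc) (R? ∘ suc) (Q⊆R ∘ suc) i ¬q r)
  ... | no _  | no _  = count-mono-< (Q? ∘ suc) (R? ∘ suc) (Q⊆R ∘ suc) i ¬q r

  count<n : ∀ {n} {Q : Fin n → Set} (Q? : ∀ i → Dec (Q i)) i → ¬ Q i → count Q? < n
  count<n Q? i ¬q = <-≤-trans (count-mono-< Q? (λ _ → yes tt) (λ _ _ → tt) i ¬q tt) (count≤n (λ _ → yes tt))

  -- This is how a sequence that doubles at each step gets pairwise distinct levels.
  ⌊log₂⌋-doubling : ∀ {a b} → 0 < a → 2 * a ≤ b → ⌊log₂ a ⌋ < ⌊log₂ b ⌋
  ⌊log₂⌋-doubling {a} 0<a 2a≤b = subst (_≤ _) (⌊log₂[2*b]⌋≡1+⌊log₂b⌋ a {{>-nonZero 0<a}}) (⌊log₂⌋-mono-≤ 2a≤b)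

  maximal : ∀ {n} {Q : Fin n → Set} (Q? : ∀ i → Dec (Q i)) (f : Fin n → ℕ) → ∃[ i ] Q i →
    ∃[ i ] (Q i × (∀ j → Q j → f j ≤ f i))
  maximal {suc n} {Q} Q? f (i , q) with Fin.any? (Q? ∘ suc)
  ... | no none = zero , case-zero i q , λ { zero _ → ≤-refl ; (suc j) r → contradiction (j , r) none }
    where
    case-zero : ∀ i → Q i → Q zero
    case-zero zero    q = q
    case-zero (suc i) q = contradiction (i , q) none
  ... | yes some with maximal (Q? ∘ suc) (f ∘ suc) some | Q? zero
  ...   | m , r , max | no ¬z = suc m , r , λ { zero z → contradiction z ¬z ; (suc j) → max j }
  ...   | m , r , max | yes z with f zero ≤? f (suc m)
  ...     | yes ≤m = suc m , r , λ { zero _ → ≤m ; (suc j) → max j }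
  ...     | no  ≰m = zero , z , λ { zero _ → ≤-refl ; (suc j) s → ≤-trans (max j s) (<⇒≤ (≰⇒> ≰m)) }

  -- Cyclic distance of points numbered by an injective rank.

  module CyclicDistance {n : ℕ} (r : Fin n → ℕ) (r<n : ∀ i → r i < n)
                        (r-injective : ∀ {i j} → r i ≡ r j → i ≡ j) where

    abstract
      -- The number of steps from x forwards to y around the cycle.
      δ : Fin n → Fin n → ℕ
      δ x y with r x ≤? r y
      ... | yes _ = r y ∸ r x
      ... | no  _ = n ∸ r x + r y

      -- The two cases tell whether the way from x to y passes from rank n - 1 to rank 0. Outside
      -- the `abstract` block nothing else is known of `δ`, so its case split never unfolds.
      δ-spec : ∀ x y → (r x ≤ r y × r x + δ x y ≡ r y) ⊎ (r y < r x × r x + δ x y ≡ r y + n)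
      δ-spec x y with r x ≤? r y
      ... | yes x≤y = inj₁ (x≤y , m+[n∸m]≡n x≤y)
      ... | no  x≰y = inj₂ (≰⇒> x≰y , trans (sym (+-assoc (r x) (n ∸ r x) (r y)))
        (trans (cong (_+ r y) (m+[n∸m]≡n (<⇒≤ (r<n x)))) (+-comm n (r y))))

    δ<n : ∀ x y → δ x y < n
    δ<n x y with δ-spec x y
    ... | inj₁ (_ , eq)   = ≤-<-trans (m+n≤o⇒n≤o (r x) (≤-reflexive eq)) (r<n y)
    ... | inj₂ (y<x , eq) = +-cancelˡ-< (r x) _ _ (subst (_< r x + n) (sym eq) (+-monoˡ-< n y<x))

    δ-refl : ∀ x → δ x x ≡ 0
    δ-refl x with δ-spec x x
    ... | inj₁ (_ , eq)   = +-cancelˡ-≡ (r x) _ _ (trans eq (sym (+-identityʳ (r x))))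
    ... | inj₂ (x<x , _) = contradiction x<x (<-irrefl refl)

    δ≡0⇒≡ : ∀ x y → δ x y ≡ 0 → x ≡ y
    δ≡0⇒≡ x y δ≡0 with δ-spec x y
    ... | inj₁ (_ , eq) = r-injective (trans (sym (trans (cong (r x +_) δ≡0) (+-identityʳ (r x)))) eq)
    ... | inj₂ (_ , eq) = contradiction
      (≤-trans (m≤n+m n (r y)) (≤-reflexive (trans (sym eq) (trans (cong (r x +_) δ≡0) (+-identityʳ (r x))))))
      (<⇒≱ (r<n x))

    0<δ : ∀ {x y} → x ≢ y → 0 < δ x y
    0<δ {x} {y} x≢y = n≢0⇒n>0 (x≢y ∘ δ≡0⇒≡ x y)

    0<δ⇒≢ : ∀ {x y} → 0 < δ x y → x ≢ y
    0<δ⇒≢ {x} 0<δxy refl = <-irrefl (sym (δ-refl x)) 0<δxy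

    δ-wraps : ∀ x y → ∃[ e ] ((e ≡ 0 ⊎ e ≡ n) × r x + δ x y ≡ r y + e)
    δ-wraps x y with δ-spec x y
    ... | inj₁ (_ , eq) = 0 , inj₁ refl , trans eq (sym (+-identityʳ (r y)))
    ... | inj₂ (_ , eq) = n , inj₂ refl , eq

    -- Modulo n both sides are the difference of the ranks of z and x. The left side is below 2n, so
    -- at most one full turn is in excess.
    δ-additive : ∀ x y z → δ x y + δ y z ≡ δ x z ⊎ δ x y + δ y z ≡ δ x z + n
    δ-additive x y z with δ-wraps x y | δ-wraps y z | δ-wraps x z
    ... | e , e∈ , eq | f , f∈ , eq′ | g , g∈ , eq″ = conclude e∈ f∈ g∈
      where
      regroup : ∀ x a b g → x + (a + b + g) ≡ x + a + b + g
      regroup = solve-∀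
      regroup₁ : ∀ y e b g → y + e + b + g ≡ y + b + (e + g)
      regroup₁ = solve-∀
      regroup₂ : ∀ z f e g → z + f + (e + g) ≡ z + g + (e + f)
      regroup₂ = solve-∀
      balance : δ x y + δ y z + g ≡ δ x z + (e + f)
      balance = +-cancelˡ-≡ (r x) _ _
        (trans (regroup (r x) (δ x y) (δ y z) g)
        (trans (cong (λ w → w + δ y z + g) eq)
        (trans (regroup₁ (r y) e (δ y z) g)
        (trans (cong (_+ (e + g)) eq′)
        (trans (regroup₂ (r z) f e g)
        (trans (cong (_+ (e + f)) (sym eq″))
        (+-assoc (r x) (δ x z) (e + f))))))))
      <2n : δ x y + δ y z < n + n
      <2n = +-mono-< (δ<n x y) (δ<n y z)
      conclude : e ≡ 0 ⊎ e ≡ n → f ≡ 0 ⊎ f ≡ n → g ≡ 0 ⊎ g ≡ n →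
        δ x y + δ y z ≡ δ x z ⊎ δ x y + δ y z ≡ δ x z + n
      conclude (inj₁ refl) (inj₁ refl) (inj₁ refl) = inj₁ (+-cancelʳ-≡ 0 _ _ balance)
      conclude (inj₁ refl) (inj₂ refl) (inj₁ refl) = inj₂ (trans (sym (+-identityʳ _)) balance)
      conclude (inj₂ refl) (inj₁ refl) (inj₁ refl) =
        inj₂ (trans (sym (+-identityʳ _)) (trans balance (cong (δ x z +_) (+-identityʳ n))))
      conclude (inj₂ refl) (inj₂ refl) (inj₁ refl) = contradiction
        (≤-trans (m≤n+m (n + n) (δ x z)) (≤-reflexive (trans (sym balance) (+-identityʳ _)))) (<⇒≱ <2n)
      conclude (inj₁ refl) (inj₁ refl) (inj₂ refl) = contradiction
        (≤-trans (m≤n+m n (δ x y + δ y z)) (≤-reflexive (trans balance (+-identityʳ _)))) (<⇒≱ (δ<n x z))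
      conclude (inj₁ refl) (inj₂ refl) (inj₂ refl) = inj₁ (+-cancelʳ-≡ n _ _ balance)
      conclude (inj₂ refl) (inj₁ refl) (inj₂ refl) =
        inj₁ (+-cancelʳ-≡ n _ _ (trans balance (cong (δ x z +_) (+-identityʳ n))))
      conclude (inj₂ refl) (inj₂ refl) (inj₂ refl) =
        inj₂ (+-cancelʳ-≡ n _ _ (trans balance (sym (+-assoc (δ x z) n n))))

    δ-split : ∀ {x y z} → δ x y ≤ δ x z → δ x z ≡ δ x y + δ y z
    δ-split {x} {y} {z} xy≤xz with δ-additive x y z
    ... | inj₁ eq = sym eq
    ... | inj₂ eq = contradiction eq (<⇒≢ (+-mono-≤-< xy≤xz (δ<n y z)))

    δ-splitʳ : ∀ {x y z} → δ y z ≤ δ x z → δ x z ≡ δ x y + δ y z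
    δ-splitʳ {x} {y} {z} yz≤xz with δ-additive x y z
    ... | inj₁ eq = sym eq
    ... | inj₂ eq = contradiction (trans eq (+-comm (δ x z) n)) (<⇒≢ (+-mono-<-≤ (δ<n x y) yz≤xz))

    δ-join : ∀ {x y z} → δ x y + δ y z < n → δ x z ≡ δ x y + δ y z
    δ-join {x} {y} {z} <n with δ-additive x y z
    ... | inj₁ eq = sym eq
    ... | inj₂ eq = contradiction (≤-trans (m≤n+m n (δ x z)) (≤-reflexive (sym eq))) (<⇒≱ <n)

    δ-complement : ∀ {x y} → x ≢ y → δ x y + δ y x ≡ n
    δ-complement {x} {y} x≢y with δ-additive x y x
    ... | inj₁ eq = contradiction (m+n≡0⇒m≡0 _ (trans eq (δ-refl x))) (x≢y ∘ δ≡0⇒≡ x y)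
    ... | inj₂ eq = trans eq (cong (_+ n) (δ-refl x))

    -- Points met in the order x, y, z on the way from p are met in this order on the way from x
    -- too: `δ p x` is subtracted throughout.
    δ-rebase-< : ∀ {p x y z} → δ p x < δ p y → δ p y < δ p z → 0 < δ x y × δ x y < δ x z
    δ-rebase-< {p} {x} {y} {z} px<py py<pz =
      +-cancelˡ-< (δ p x) _ _ (subst₂ _<_ (sym (+-identityʳ _)) (δ-split (<⇒≤ px<py)) px<py) ,
      +-cancelˡ-< (δ p x) _ _ (subst₂ _<_ (δ-split (<⇒≤ px<py)) (δ-split (<⇒≤ (<-trans px<py py<pz))) py<pz)

    -- The three cases are the rotations of the cyclic order x, y, z, according to which point has
    -- the least rank.
    cyclic-rank : ∀ {x y z} → 0 < δ x y → δ x y < δ x z →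
      (r x < r y × r y < r z) ⊎ (r y < r z × r z < r x) ⊎ (r z < r x × r x < r y)
    cyclic-rank {x} {y} {z} 0<xy xy<xz with δ-spec x y | δ-spec x z
    ... | inj₁ (_ , eq) | inj₁ (_ , eq′) = inj₁
      (subst₂ _<_ (+-identityʳ (r x)) eq (+-monoʳ-< (r x) 0<xy) , subst₂ _<_ eq eq′ (+-monoʳ-< (r x) xy<xz))
    ... | inj₁ (_ , eq) | inj₂ (z<x , _) =
      inj₂ (inj₂ (z<x , subst₂ _<_ (+-identityʳ (r x)) eq (+-monoʳ-< (r x) 0<xy)))
    ... | inj₂ (_ , eq) | inj₁ (_ , eq′) = contradiction
      (≤-<-trans (m≤n+m n (r y)) (subst₂ _<_ eq eq′ (+-monoʳ-< (r x) xy<xz))) (<-asym (r<n z))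
    ... | inj₂ (_ , eq) | inj₂ (z<x , eq′) =
      inj₂ (inj₁ (+-cancelʳ-< n _ _ (subst₂ _<_ eq eq′ (+-monoʳ-< (r x) xy<xz)) , z<x))

    -- Injective coding of arcs that avoid the forbidden configuration.

    module Coding
      (E : Fin n → Fin n → Set) (E? : ∀ p b → Dec (E p b)) (E-irrefl : ∀ {p b} → E p b → p ≢ b)
      (avoids : ∀ {p q b c d} → E p b → E q b → E q c → E p d →
        0 < δ p q → δ p q < δ p b → δ p b < δ p c → δ p c ≤ δ p d → ⊥) where

      -- In `far` the arc to d is the outer arc to which `avoids` will be applied; `classify` takes
      -- the longest arc from p for it. `near` says that no c qualifies when d is that longest arc.
      data Class (p b : Fin n) : Set where
        last : (∀ c → E p c → δ p c ≤ δ p b) → Class p b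
        far  : ∀ c d → E p c → E p d → δ p b < δ p c → δ p c ≤ δ p d → 2 * δ b c ≤ δ b d → Class p b
        near : ∀ l → E p l → (∀ c → E p c → δ p c ≤ δ p l) → δ p b < δ p l →
          (∀ c → E p c → δ p b < δ p c → δ b l < 2 * δ b c) → Class p b

      classify : ∀ {p b} → E p b → Class p b
      classify {p} {b} pb with maximal (E? p) (δ p) (b , pb)
      ... | l , pl , max with δ p b <? δ p l
      ...   | no  ≮ = last (λ c pc → ≤-trans (max c pc) (≮⇒≥ ≮))
      ...   | yes b<l with Fin.any? (λ c → E? p c ×-dec δ p b <? δ p c ×-dec 2 * δ b c ≤? δ b l)
      ...     | yes (c , pc , b<c , ≤) = far c l pc pl b<c (max c pc) ≤
      ...     | no  none = near l pl max b<l (λ c pc b<c → ≰⇒> λ ≤ → none (c , pc , b<c , ≤))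

      -- The logarithms range from 0 to `⌊log₂ n ⌋` inclusive, hence the successor.
      levels : ℕ
      levels = suc ⌊log₂ n ⌋

      level<levels : ∀ b c → ⌊log₂ δ b c ⌋ < levels
      level<levels b c = s≤s (⌊log₂⌋-mono-≤ (<⇒≤ (δ<n b c)))

      level : Fin n → Fin n → Fin levels
      level b c = fromℕ< (level<levels b c)

      level-injective : ∀ b c b′ c′ → level b c ≡ level b′ c′ → ⌊log₂ δ b c ⌋ ≡ ⌊log₂ δ b′ c′ ⌋
      level-injective b c b′ c′ = Fin.fromℕ<-injective _ _ (level<levels b c) (level<levels b′ c′)

      Code : Set
      Code = (Fin n × Fin levels) ⊎ (Fin n × Fin levels) ⊎ Fin n

      code : ∀ {p b} → Class p b → Code
      code {p} {b} (far c _ _ _ _ _ _)  = inj₁ (b , level b c)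
      code {p} {b} (near l _ _ _ _)     = inj₂ (inj₁ (p , level b l))
      code {p} {b} (last _)             = inj₂ (inj₂ p)

      δ-injectiveʳ : ∀ {p b c} → δ p b ≡ δ p c → b ≡ c
      δ-injectiveʳ {p} {b} {c} eq = δ≡0⇒≡ b c (+-cancelˡ-≡ (δ p b) _ _
        (trans (sym (δ-split (≤-reflexive eq))) (trans (sym eq) (sym (+-identityʳ _)))))

      δ-injectiveˡ : ∀ {p q b} → δ p b ≡ δ q b → p ≡ q
      δ-injectiveˡ {p} {q} {b} eq = δ≡0⇒≡ p q (+-cancelʳ-≡ (δ q b) _ _
        (trans (sym (δ-splitʳ (≤-reflexive (sym eq)))) eq))

      0<δ-next : ∀ {p b c} → δ p b < δ p c → 0 < δ b c
      0<δ-next {p} {b} b<c = 0<δ λ { refl → <-irrefl refl b<c }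

      -- The tail q lies between p and b. If c′ came before d, the arcs p → b, q → b, q → c′, p → d
      -- would be forbidden, so `δ b c′` is at least `δ b d`, which is at least twice `δ b c`.
      far-doubling : ∀ {p q b c d c′} → E p b → E p d → δ p b < δ p c → δ p c ≤ δ p d → 2 * δ b c ≤ δ b d →
        E q b → E q c′ → δ q b < δ q c′ → δ q b < δ p b → ⌊log₂ δ b c ⌋ < ⌊log₂ δ b c′ ⌋
      far-doubling {p} {q} {b} {c} {d} {c′} pb pd b<c c≤d 2bc≤bd qb qc′ b<c′ qb<pb =
        ⌊log₂⌋-doubling (0<δ-next b<c) (≤-trans 2bc≤bd (≮⇒≥ ¬<))
        where
        pd≡ : δ p d ≡ δ p b + δ b d
        pd≡ = δ-split (≤-trans (<⇒≤ b<c) c≤d)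
        pb≡ : δ p b ≡ δ p q + δ q b
        pb≡ = δ-splitʳ (<⇒≤ qb<pb)
        ¬< : ¬ (δ b c′ < δ b d)
        ¬< bc′<bd = avoids pb qb qc′ pd
          (+-cancelʳ-< (δ q b) _ _ (subst (δ q b <_) pb≡ qb<pb))
          (subst (δ p q <_) (sym pb≡) (m<m+n (δ p q) (0<δ (E-irrefl qb))))
          (subst (δ p b <_) (sym pc′≡) (m<m+n (δ p b) (0<δ-next b<c′)))
          (<⇒≤ pc′<pd)
          where
          sum<pd : δ p b + δ b c′ < δ p d
          sum<pd = subst (δ p b + δ b c′ <_) (sym pd≡) (+-monoʳ-< (δ p b) bc′<bd)
          -- The sum is below `δ p d`, hence below n: going on from b to c′ does not pass p again.
          pc′≡ : δ p c′ ≡ δ p b + δ b c′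
          pc′≡ = δ-join (<-trans sum<pd (δ<n p d))
          pc′<pd : δ p c′ < δ p d
          pc′<pd = subst (_< δ p d) (sym pc′≡) sum<pd

      -- The point b′ divides the way from b to l, and by the gap condition its first part is more
      -- than half of the whole.
      near-halving : ∀ {p b l b′} → δ p b < δ p b′ → δ p b′ < δ p l → δ b l < 2 * δ b b′ →
        ⌊log₂ δ b′ l ⌋ < ⌊log₂ δ b l ⌋
      near-halving {p} {b} {l} {b′} b<b′ b′<l bl<2bb′ = ⌊log₂⌋-doubling (0<δ-next b′<l)
        (subst₂ _≤_ (cong (δ b′ l +_) (sym (+-identityʳ _))) (sym bl≡) (+-monoˡ-≤ (δ b′ l) (<⇒≤ b′l<bb′)))
        where
        bl≡ : δ b l ≡ δ b b′ + δ b′ l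
        bl≡ = δ-split (<⇒≤ (proj₂ (δ-rebase-< b<b′ b′<l)))
        b′l<bb′ : δ b′ l < δ b b′
        b′l<bb′ = +-cancelˡ-< (δ b b′) _ _
          (subst₂ _<_ bl≡ (cong (δ b b′ +_) (+-identityʳ _)) bl<2bb′)

      -- Equal codes give a common head for far arcs and a common tail for the others. If the other
      -- ends differed, one of them would come first, and the levels would differ by doubling or
      -- halving.
      code-injective : ∀ {p b q b′} → E p b → E q b′ → (x : Class p b) (y : Class q b′) →
        code x ≡ code y → p ≡ q × b ≡ b′
      code-injective pb qb′ (last max) (last max′) refl =
        refl , δ-injectiveʳ (≤-antisym (max′ _ pb) (max _ qb′))
      code-injective {p} {b} {q} pb qb (far c d pc pd b<c c≤d ≤d) (far c′ d′ qc′ qd′ b<c′ c′≤d′ ≤d′) eq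
        with ,-injective (inj₁-injective eq)
      ... | refl , eq′ with level-injective b c b c′ eq′ | <-cmp (δ p b) (δ q b)
      ...   | _  | tri≈ _ p≡q _ = δ-injectiveˡ p≡q , refl
      ...   | eq″ | tri< p<q _ _ =
        contradiction (sym eq″) (<⇒≢ (far-doubling qb qd′ b<c′ c′≤d′ ≤d′ pb pc b<c p<q))
      ...   | eq″ | tri> _ _ q<p =
        contradiction eq″ (<⇒≢ (far-doubling pb pd b<c c≤d ≤d qb qc′ b<c′ q<p))
      code-injective {p} {b} {_} {b′} pb pb′ (near l pl max b<l gap) (near l′ pl′ max′ b′<l′ gap′) eq
        with ,-injective (inj₁-injective (inj₂-injective eq))
      -- Both l and l′ end a longest arc from p, so they coincide and the levels are measured to the
      -- same point.
      ... | refl , eq′ with δ-injectiveʳ (≤-antisym (max′ l pl) (max l′ pl′))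
      ...   | refl with level-injective b l b′ l eq′ | <-cmp (δ p b) (δ p b′)
      ...     | _   | tri≈ _ b≡b′ _ = refl , δ-injectiveʳ b≡b′
      ...     | eq″ | tri< b<b′ _ _ =
        contradiction (sym eq″) (<⇒≢ (near-halving b<b′ b′<l′ (gap b′ pb′ b<b′)))
      ...     | eq″ | tri> _ _ b′<b =
        contradiction eq″ (<⇒≢ (near-halving b′<b b<l (gap′ b pb b′<b)))

      Code↣Fin : Code ↣ Fin (n * levels + (n * levels + n))
      Code↣Fin = ↔⇒↣ (↔-sym (↔-trans Fin.+↔⊎ (Fin.*↔× ⊎-↔ ↔-trans Fin.+↔⊎ (Fin.*↔× ⊎-↔ ↔-refl))))

      number-of-edges : ∀ {m} (e : Fin m → Fin n × Fin n) → (∀ i → E (proj₁ (e i)) (proj₂ (e i))) →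
        (∀ {i j} → e i ≡ e j → i ≡ j) → m ≤ n * levels + (n * levels + n)
      number-of-edges e e∈E e-injective =
        Fin.injective⇒≤ {f = λ i → Injection.to Code↣Fin (code (classify (e∈E i)))} λ {i} {j} eq →
          let p≡q , b≡b′ = code-injective (e∈E i) (e∈E j) (classify (e∈E i)) (classify (e∈E j))
                             (Injection.injective Code↣Fin eq)
          in e-injective (cong₂ _,_ p≡q b≡b′)

  -- The double negation shift, provable by induction because the index type is finite. It allows
  -- finitely many classical choices to be made at once.
  ¬¬-∀ : ∀ {n} {Q : Fin n → Set} → (∀ i → ¬ ¬ Q i) → ¬ ¬ (∀ i → Q i)
  ¬¬-∀ {zero}  q k = k λ ()
  ¬¬-∀ {suc n} q k = q zero λ q₀ → ¬¬-∀ (q ∘ suc) λ qₛ → k λ { zero → q₀ ; (suc i) → qₛ i }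

  -- A refutation of `A → B` refutes `B`, so with f it refutes `A`; but then `A → B` holds
  -- vacuously.
  ¬¬-→ : ∀ {A B : Set} → (A → ¬ ¬ B) → ¬ ¬ (A → B)
  ¬¬-→ f k = k λ a → ⊥-elim (f a λ b → k λ _ → b)

  unique⇒lookup-injective : ∀ {A : Set} {xs : List A} → Unique xs → ∀ {i j} → lookup xs i ≡ lookup xs j → i ≡ j
  unique⇒lookup-injective (_ ∷ _)   {zero}  {zero}  _  = refl
  unique⇒lookup-injective (x∉ ∷ _)  {zero}  {suc j} eq = contradiction eq (All.lookup x∉ (∈-lookup j))
  unique⇒lookup-injective (x∉ ∷ _)  {suc i} {zero}  eq = contradiction (sym eq) (All.lookup x∉ (∈-lookup i))
  unique⇒lookup-injective (_ ∷ uxs) {suc i} {suc j} eq = cong suc (unique⇒lookup-injective uxs eq)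

  -- The cyclic order of points in convex position, from axioms of orientation.

  module ConvexOrientation {m : ℕ} (L : Fin (suc m) → Fin (suc m) → Fin (suc m) → Set)
    (L-rotate : ∀ {i j k} → L i j k → L j k i)
    (L-asym : ∀ {i j k} → L i j k → ¬ L i k j)
    (L-total : ∀ i j k → i ≢ j → i ≢ k → j ≢ k → L i j k ⊎ L i k j)
    (L-no-triangle : ∀ {x a b c} → L x a b → L x b c → ¬ L x c a) where

    L⇒≢₂₃ : ∀ {i j k} → L i j k → j ≢ k
    L⇒≢₂₃ l refl = L-asym l l

    L⇒≢₁₂ : ∀ {i j k} → L i j k → i ≢ j
    L⇒≢₁₂ = L⇒≢₂₃ ∘ L-rotate ∘ L-rotate

    L⇒≢₁₃ : ∀ {i j k} → L i j k → i ≢ k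
    L⇒≢₁₃ = (λ ne → ne ∘ sym) ∘ L⇒≢₂₃ ∘ L-rotate

    -- Otherwise i, j, k would wind once around o, which would lie inside their triangle.
    L-trans : ∀ {o i j k} → L o i j → L o j k → L o i k
    L-trans {o} {i} {j} {k} oij ojk with L-total o i k (L⇒≢₁₂ oij) (L⇒≢₁₃ ojk) i≢k
      where
      i≢k : i ≢ k
      i≢k refl = L-asym oij ojk
    ... | inj₁ oik = oik
    ... | inj₂ oki = contradiction oki (L-no-triangle oij ojk)

    -- Otherwise j would lie inside the triangle o, i, k.
    L-interior : ∀ {o i j k} → L o i j → L o j k → L i j k
    L-interior {o} {i} {j} {k} oij ojk with L-total i j k (L⇒≢₂₃ oij) (L⇒≢₂₃ (L-trans oij ojk)) (L⇒≢₂₃ ojk)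
    ... | inj₁ ijk = ijk
    ... | inj₂ ikj = contradiction (L-rotate ojk)
      (L-no-triangle (L-rotate (L-rotate oij)) (L-rotate (L-rotate ikj)))

    infix 4 _≺_
    -- The angular order as seen from the point `zero`, which itself comes first.
    _≺_ : Fin (suc m) → Fin (suc m) → Set
    i ≺ j = (i ≡ zero × j ≢ zero) ⊎ L zero i j

    ≺-irrefl : ∀ {i} → ¬ i ≺ i
    ≺-irrefl (inj₁ (i≡0 , i≢0)) = i≢0 i≡0
    ≺-irrefl (inj₂ l)           = L⇒≢₂₃ l refl

    ≺-trans : ∀ {i j k} → i ≺ j → j ≺ k → i ≺ k
    ≺-trans (inj₁ (_ , j≢0))   (inj₁ (j≡0 , _)) = contradiction j≡0 j≢0
    ≺-trans (inj₁ (i≡0 , _))   (inj₂ l)         = inj₁ (i≡0 , L⇒≢₁₃ l ∘ sym)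
    ≺-trans (inj₂ l)           (inj₁ (j≡0 , _)) = contradiction (sym j≡0) (L⇒≢₁₃ l)
    ≺-trans (inj₂ l)           (inj₂ l′)        = inj₂ (L-trans l l′)

    ≺-total : ∀ i j → i ≢ j → i ≺ j ⊎ j ≺ i
    ≺-total i j i≢j with i Fin.≟ zero | j Fin.≟ zero
    ... | yes refl | _        = inj₁ (inj₁ (refl , i≢j ∘ sym))
    ... | no  i≢0  | yes j≡0  = inj₂ (inj₁ (j≡0 , i≢0))
    ... | no  i≢0  | no  j≢0  with L-total zero i j (i≢0 ∘ sym) (j≢0 ∘ sym) i≢j
    ...   | inj₁ l = inj₁ (inj₂ l)
    ...   | inj₂ l = inj₂ (inj₂ l)

    _≺?_ : ∀ i j → Dec (i ≺ j)
    i ≺? j with i Fin.≟ j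
    ... | yes refl = no ≺-irrefl
    ... | no  i≢j with ≺-total i j i≢j
    ...   | inj₁ i≺j = yes i≺j
    ...   | inj₂ j≺i = no λ i≺j → ≺-irrefl (≺-trans i≺j j≺i)

    ≺⇒L : ∀ {i j k} → i ≺ j → j ≺ k → L i j k
    ≺⇒L (inj₁ (_ , j≢0))    (inj₁ (j≡0 , _)) = contradiction j≡0 j≢0
    ≺⇒L (inj₁ (refl , _))   (inj₂ l)         = l
    ≺⇒L (inj₂ l)            (inj₁ (j≡0 , _)) = contradiction (sym j≡0) (L⇒≢₁₃ l)
    ≺⇒L (inj₂ l)            (inj₂ l′)        = L-interior l l′

    rank : Fin (suc m) → ℕ
    rank i = count (_≺? i)

    rank-mono : ∀ {i j} → i ≺ j → rank i < rank j
    rank-mono {i} {j} i≺j =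
      count-mono-< (_≺? i) (_≺? j) (λ k k≺i → ≺-trans k≺i i≺j) i ≺-irrefl i≺j

    rank<n : ∀ i → rank i < suc m
    rank<n i = count<n (_≺? i) i ≺-irrefl

    rank-injective : ∀ {i j} → rank i ≡ rank j → i ≡ j
    rank-injective {i} {j} eq with i Fin.≟ j
    ... | yes i≡j = i≡j
    ... | no  i≢j with ≺-total i j i≢j
    ...   | inj₁ i≺j = contradiction eq (<⇒≢ (rank-mono i≺j))
    ...   | inj₂ j≺i = contradiction (sym eq) (<⇒≢ (rank-mono j≺i))

    rank-reflects-≺ : ∀ {i j} → rank i < rank j → i ≺ j
    rank-reflects-≺ {i} {j} i<j with ≺-total i j (λ { refl → <-irrefl refl i<j })
    ... | inj₁ i≺j = i≺j
    ... | inj₂ j≺i = contradiction (rank-mono j≺i) (<-asym i<j)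

    open CyclicDistance rank rank<n rank-injective public

    -- Some rotation of the triple has increasing ranks and falls under `≺⇒L`; `L` is invariant
    -- under rotation.
    cyclic⇒L : ∀ {x y z} → 0 < δ x y → δ x y < δ x z → L x y z
    cyclic⇒L 0<xy xy<xz with cyclic-rank 0<xy xy<xz
    ... | inj₁ (x<y , y<z)        = ≺⇒L (rank-reflects-≺ x<y) (rank-reflects-≺ y<z)
    ... | inj₂ (inj₁ (y<z , z<x)) = L-rotate (L-rotate (≺⇒L (rank-reflects-≺ y<z) (rank-reflects-≺ z<x)))
    ... | inj₂ (inj₂ (z<x , x<y)) = L-rotate (≺⇒L (rank-reflects-≺ z<x) (rank-reflects-≺ x<y))

    increasing⇒L : ∀ {p x y z} → δ p x < δ p y → δ p y < δ p z → L x y z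
    increasing⇒L px<py py<pz = let 0<xy , xy<xz = δ-rebase-< px<py py<pz in cyclic⇒L 0<xy xy<xz

    -- Bent pairs, and the directing of unit edges.

    module UnitEdges
      (Unit : Fin (suc m) → Fin (suc m) → Set)
      (Acute : Fin (suc m) → Fin (suc m) → Fin (suc m) → Set)
      (isosceles : ∀ {p q b} → p ≢ q → Unit p b → Unit q b → Acute p q b)
      (acute-sym : ∀ {p q r} → Acute p q r → Acute r q p)
      (Unit-sym : ∀ {p q} → Unit p q → Unit q p)
      (shrinkˡ : ∀ {p q b y} → L q b y → L q y p → L q b p → Acute p q b → Acute y q b)
      (shrinkʳ : ∀ {q b c x} → L b c x → L b x q → L b c q → Acute q b c → Acute q b x)
      (¬-four-acute : ∀ {p q r s} → L p q r → L q r s → L r s p → L s p q →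
        Acute p q r → Acute q r s → Acute r s p → Acute s p q → ⊥)
      (Unit-irrefl : ∀ {p b} → Unit p b → p ≢ b)
      where

      -- The arc from p to d contains a unit path p - b - q - c with p < q < b < c;
      -- its acute angles at q and b make the polygon turn by more than π between p and d.
      record Bent (p d : Fin (suc m)) : Set where
        constructor bent
        field
          {q b c} : Fin (suc m)
          0<pq    : 0 < δ p q
          pq<pb   : δ p q < δ p b
          pb<pc   : δ p b < δ p c
          pc≤pd   : δ p c ≤ δ p d
          pb      : Unit p b
          qb      : Unit q b
          qc      : Unit q c

      -- The isosceles triangles p b q and b q c have acute angles at q and b. With x and y beyond
      -- d, replacing p by y in the first angle and c by x in the second only narrows them.
      bent-angles : ∀ {p d x y} (β : Bent p d) (let open Bent β) → p ≢ d →
        0 < δ d x → δ d x < δ d y → δ d y < δ d p →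
        Acute y q b × Acute q b x × L q b x × L b x y
      bent-angles {p} {d} {x} {y} (bent {q} {b} {c} 0<pq pq<pb pb<pc pc≤pd pb qb qc) p≢d 0<dx dx<dy dy<dp =
        shrinkˡ (increasing⇒L pq<pb (<-trans pb<px px<py)) (L-rotate (cyclic⇒L 0<pq pq<py))
          (L-rotate (cyclic⇒L 0<pq pq<pb)) (isosceles p≢q pb qb) ,
        shrinkʳ (increasing⇒L pb<pc pc<px) (L-rotate qbx) (L-rotate (increasing⇒L pq<pb pb<pc))
          (acute-sym (isosceles c≢b (Unit-sym qc) (Unit-sym qb))) ,
        qbx ,
        increasing⇒L pb<px px<py
        where
        position : ∀ {z} → δ d z < δ d p → δ p z ≡ δ p d + δ d z
        position {z} dz<dp = δ-join (subst (δ p d + δ d z <_) (δ-complement p≢d) (+-monoʳ-< (δ p d) dz<dp))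
        px≡ : δ p x ≡ δ p d + δ d x
        px≡ = position (<-trans dx<dy dy<dp)
        py≡ : δ p y ≡ δ p d + δ d y
        py≡ = position dy<dp
        pc<px : δ p c < δ p x
        pc<px = ≤-<-trans pc≤pd (subst (δ p d <_) (sym px≡) (m<m+n (δ p d) 0<dx))
        px<py : δ p x < δ p y
        px<py = subst₂ _<_ (sym px≡) (sym py≡) (+-monoʳ-< (δ p d) dx<dy)
        pb<px : δ p b < δ p x
        pb<px = <-trans pb<pc pc<px
        pq<py : δ p q < δ p y
        pq<py = <-trans pq<pb (<-trans pb<px px<py)
        qbx : L q b x
        qbx = increasing⇒L pq<pb pb<px
        p≢q : p ≢ q
        p≢q = 0<δ⇒≢ 0<pq
        c≢b : c ≢ b
        c≢b refl = <-irrefl refl pb<pc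

      -- Let q, b come from one side and q′, b′ from the other. Each path sees the other pair beyond
      -- its end, so all four angles of the quadrilateral q b q′ b′ are acute.
      ¬-bent-twice : ∀ {p d} → p ≢ d → Bent p d → Bent d p → ⊥
      ¬-bent-twice p≢d β β′ =
        let ∠q  , ∠b  , qbq′ , bq′b′ = bent-angles β p≢d (0<pq β′) (pq<pb β′) (<-≤-trans (pb<pc β′) (pc≤pd β′))
            ∠q′ , ∠b′ , q′b′q , b′qb = bent-angles β′ (p≢d ∘ sym) (0<pq β) (pq<pb β) (<-≤-trans (pb<pc β) (pc≤pd β))
        in ¬-four-acute qbq′ bq′b′ q′b′q b′qb ∠b ∠q′ ∠b′ ∠q
        where open Bent

      -- Both directions of a unit edge may qualify; `direct` chooses one of them.
      Arc : Fin (suc m) → Fin (suc m) → Set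
      Arc p d = Unit p d × ¬ Bent p d

      arcs-avoid : ∀ {p q b c d} → Arc p b → Arc q b → Arc q c → Arc p d →
        0 < δ p q → δ p q < δ p b → δ p b < δ p c → δ p c ≤ δ p d → ⊥
      arcs-avoid (pb , _) (qb , _) (qc , _) (_ , ¬β) 0<pq pq<pb pb<pc pc≤pd =
        ¬β (bent 0<pq pq<pb pb<pc pc≤pd pb qb qc)

      ¬¬straight : ∀ p d → p ≢ d → ¬ ¬ (¬ Bent p d ⊎ ¬ Bent d p)
      ¬¬straight p d p≢d k = k (inj₁ λ β → k (inj₂ λ β′ → ¬-bent-twice p≢d β β′))

      Edge : Fin (suc m) × Fin (suc m) → Set
      Edge (i , j) = i Fin.< j × Unit i j

      Arc′ : Fin (suc m) × Fin (suc m) → Set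
      Arc′ (p , d) = Arc p d

      direct : (∀ p d → p ≢ d → ¬ Bent p d ⊎ ¬ Bent d p) →
        ∀ {e} → Edge e → ∃[ a ] (Arc′ a × (a ≡ e ⊎ a ≡ swap e))
      direct straight {i , j} (i<j , ij) with straight i j (Fin.<⇒≢ i<j)
      ... | inj₁ ¬β = (i , j) , (ij , ¬β) , inj₁ refl
      ... | inj₂ ¬β = (j , i) , (Unit-sym ij , ¬β) , inj₂ refl

      ¬edge-swap : ∀ {e f} → Edge e → Edge f → e ≢ swap f
      ¬edge-swap (i<j , _) (j<i , _) refl = Fin.<-asym i<j j<i

      -- An edge has its smaller index first, so an arc, in whichever direction, comes from one edge
      -- only.
      same-edge : ∀ {e f a} → Edge e → Edge f → a ≡ e ⊎ a ≡ swap e → a ≡ f ⊎ a ≡ swap f → e ≡ f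
      same-edge _ _ (inj₁ refl) (inj₁ refl) = refl
      same-edge e f (inj₁ refl) (inj₂ eq)   = contradiction eq (¬edge-swap e f)
      same-edge e f (inj₂ eq)   (inj₁ refl) = contradiction eq (¬edge-swap f e)
      same-edge _ _ (inj₂ refl) (inj₂ eq)   = cong swap eq

      edges≤bound : ∀ es → Unique es → All Edge es →
        ¬ ¬ (length es ≤ suc m * suc ⌊log₂ suc m ⌋ + (suc m * suc ⌊log₂ suc m ⌋ + suc m))
      edges≤bound es unique edges ≰ =
        -- `Arc` need not be decidable and the choice of a direction is classical. Since the goal is
        -- a double negation, both may be assumed for all pairs.
        ¬¬-∀ (λ p → ¬¬-∀ λ d → ¬¬-excluded-middle {A = Arc p d}) λ Arc? →
        ¬¬-∀ (λ p → ¬¬-∀ λ d → ¬¬-→ (¬¬straight p d)) λ straight →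
        let edge     = λ i → All.lookup edges (∈-lookup i)
            directed = λ i → direct straight (edge i)
        in ≰ (Coding.number-of-edges Arc Arc? (Unit-irrefl ∘ proj₁) arcs-avoid
          (proj₁ ∘ directed) (proj₁ ∘ proj₂ ∘ directed)
          λ {i} {j} eq → unique⇒lookup-injective unique (same-edge (edge i) (edge j)
            (proj₂ (proj₂ (directed i)))
            (subst (λ a → a ≡ _ ⊎ a ≡ _) (sym eq) (proj₂ (proj₂ (directed j))))))

open CyclicCombinatorics

open import Defs
open import Data.Integer using (+_)
open import Data.Vec.Functional using (Vector; []; _∷_)
open CauchyLemmas using (half-pos; half+half; eventually-bounded; quotient; ∣*∣-<)
open LogLemmas using (/-mono; 2^⌊log₂⌋≤n)

-- Cauchy reals

p≤∣p∣ : ∀ p → p ℚ.≤ ∣ p ∣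
p≤∣p∣ p with ℚ.∣p∣≡p∨∣p∣≡-p p
... | inj₁ eq = ℚ.≤-reflexive (sym eq)
... | inj₂ eq = ℚ.≤-trans
  (subst (ℚ._≤ 0ℚ) (trans (cong ℚ.-_ eq) (neg-involutive p)) (ℚ.neg-antimono-≤ (ℚ.0≤∣p∣ p)))
  (ℚ.0≤∣p∣ p)
  where
  open +-*-Solver
  neg-involutive : ∀ a → ℚ.- (ℚ.- a) ≡ a
  neg-involutive = solve 1 (λ a → :- (:- a) := a) refl

Eventually : (ℕ → Set) → Set
Eventually Q = ∃[ N ] (∀ n → N ℕ.≤ n → Q n)

eventually-map : ∀ {Q R : ℕ → Set} → (∀ n → Q n → R n) → Eventually Q → Eventually R
eventually-map f (N , q) = N , λ n N≤n → f n (q n N≤n)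

eventually-zip : ∀ {Q R S : ℕ → Set} → (∀ n → Q n → R n → S n) →
  Eventually Q → Eventually R → Eventually S
eventually-zip f (M , q) (N , r) = M ℕ.⊔ N , λ n l →
  f n (q n (ℕ.m⊔n≤o⇒m≤o M N l)) (r n (ℕ.m⊔n≤o⇒n≤o M N l))

-- `x ≈ y` unfolds to `Null` of the termwise difference, so equalities of reals are proved and used
-- as null sequences.
Null : (ℕ → ℚ) → Set
Null s = ∀ ε → 0ℚ ℚ.< ε → Eventually (λ n → ∣ s n ∣ ℚ.< ε)

null-resp : ∀ {s t} → (∀ n → s n ≡ t n) → Null s → Null t
null-resp s≡t s→0 ε 0<ε =
  eventually-map (λ n → subst (λ r → ∣ r ∣ ℚ.< ε) (s≡t n)) (s→0 ε 0<ε)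

null-0 : Null (λ _ → 0ℚ)
null-0 ε 0<ε = 0 , λ _ _ → 0<ε

null-+ : ∀ {s t} → Null s → Null t → Null (λ n → s n ℚ.+ t n)
null-+ {s} {t} s→0 t→0 ε 0<ε = eventually-zip
  (λ n s<ε t<ε → subst (∣ s n ℚ.+ t n ∣ ℚ.<_) (half+half ε)
    (ℚ.≤-<-trans (ℚ.∣p+q∣≤∣p∣+∣q∣ (s n) (t n)) (ℚ.+-mono-< s<ε t<ε)))
  (s→0 (½ ℚ.* ε) (half-pos 0<ε)) (t→0 (½ ℚ.* ε) (half-pos 0<ε))

null-neg : ∀ {s} → Null s → Null (λ n → ℚ.- s n)
null-neg {s} s→0 ε 0<ε =
  eventually-map (λ n → subst (ℚ._< ε) (sym (ℚ.∣-p∣≡∣p∣ (s n)))) (s→0 ε 0<ε)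

null-* : ∀ x {s} → Null s → Null (λ n → seq x n ℚ.* s n)
null-* x {s} s→0 ε 0<ε =
  let B , N , 0<B , x≤B = eventually-bounded (seq x) (cauchy x)
      δ , 0<δ , Bδ≡ε    = quotient B ε 0<B 0<ε
  in eventually-zip
       (λ n x≤B s<δ → subst (∣ seq x n ℚ.* s n ∣ ℚ.<_) Bδ≡ε (∣*∣-< (seq x n) (s n) 0<B x≤B s<δ))
       (N , x≤B) (s→0 δ 0<δ)

≈-refl : ∀ x → x ≈ x
≈-refl x = null-resp (λ n → sym (ℚ.+-inverseʳ (seq x n))) null-0

≈ₚ-refl : ∀ p → p ≈ₚ p
≈ₚ-refl (x , y) = ≈-refl x , ≈-refl y

-- Strict positivity, witnessed by a rational lower bound. It speaks of sequences, so that
-- polynomial identities between terms carry it over by `pos-resp`.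
record Pos (s : ℕ → ℚ) : Set where
  constructor mkPos
  field
    bound     : ℚ
    0<bound   : 0ℚ ℚ.< bound
    bound<seq : Eventually (λ n → bound ℚ.< s n)

pos-resp : ∀ {s t} → (∀ n → s n ≡ t n) → Pos s → Pos t
pos-resp s≡t (mkPos ε 0<ε ev) = mkPos ε 0<ε (eventually-map (λ n → subst (ε ℚ.<_) (s≡t n)) ev)

0≤p*p : ∀ p → 0ℚ ℚ.≤ p ℚ.* p
0≤p*p p = subst₂ ℚ._≤_ (ℚ.*-zeroʳ ∣ p ∣) ∣p∣²≡p²
  (ℚ.*-monoˡ-≤-nonNeg ∣ p ∣ {{ℚ.∣-∣-nonNeg p}} (ℚ.0≤∣p∣ p))
  where
  ∣p∣²≡p² : ∣ p ∣ ℚ.* ∣ p ∣ ≡ p ℚ.* p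
  ∣p∣²≡p² with ℚ.∣p∣≡p∨∣p∣≡-p p
  ... | inj₁ eq = cong₂ ℚ._*_ eq eq
  ... | inj₂ eq = trans (cong₂ ℚ._*_ eq eq) (solve 1 (λ a → (:- a) :* (:- a) := a :* a) refl p)
    where open +-*-Solver

*-pos : ∀ {p q} → 0ℚ ℚ.< p → 0ℚ ℚ.< q → 0ℚ ℚ.< p ℚ.* q
*-pos {p} {q} 0<p 0<q = subst (ℚ._< p ℚ.* q) (ℚ.*-zeroʳ p) (ℚ.*-monoʳ-<-pos p {{ℚ.positive 0<p}} 0<q)

*-mono-<-pos : ∀ {a b c d} → 0ℚ ℚ.< a → 0ℚ ℚ.< c → a ℚ.< b → c ℚ.< d → a ℚ.* c ℚ.< b ℚ.* d
*-mono-<-pos {a} {b} {c} {d} 0<a 0<c a<b c<d = ℚ.<-trans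
  (ℚ.*-monoʳ-<-pos a {{ℚ.positive 0<a}} c<d)
  (ℚ.*-monoˡ-<-pos d {{ℚ.positive (ℚ.<-trans 0<c c<d)}} a<b)

pos-fromℚ : ∀ {q} → 0ℚ ℚ.< q → Pos (λ _ → q)
pos-fromℚ {q} 0<q = mkPos (½ ℚ.* q) (half-pos 0<q) (0 , λ _ _ →
  subst₂ ℚ._<_ (ℚ.+-identityʳ (½ ℚ.* q)) (half+half q) (ℚ.+-monoʳ-< (½ ℚ.* q) (half-pos 0<q)))

pos-+ : ∀ {s t} → Pos s → Pos t → Pos (λ n → s n ℚ.+ t n)
pos-+ (mkPos ε 0<ε ev) (mkPos δ 0<δ ev′) =
  mkPos (ε ℚ.+ δ) (ℚ.+-mono-< 0<ε 0<δ) (eventually-zip (λ _ → ℚ.+-mono-<) ev ev′)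

pos-* : ∀ {s t} → Pos s → Pos t → Pos (λ n → s n ℚ.* t n)
pos-* (mkPos ε 0<ε ev) (mkPos δ 0<δ ev′) =
  mkPos (ε ℚ.* δ) (*-pos 0<ε 0<δ) (eventually-zip (λ _ → *-mono-<-pos 0<ε 0<δ) ev ev′)

pos-¬null : ∀ {s} → Pos s → ¬ Null s
pos-¬null {s} (mkPos ε 0<ε (M , f)) s→0 with s→0 ε 0<ε
... | N , g = ℚ.<-asym (f k (ℕ.m≤m⊔n M N))
  (ℚ.≤-<-trans (p≤∣p∣ (s k)) (g k (ℕ.m≤n⊔m M N)))
  where k = M ℕ.⊔ N

pos-asym : ∀ {s} → Pos s → ¬ Pos (λ n → ℚ.- s n)
pos-asym {s} p q = pos-¬null (pos-+ p q) (null-resp (λ n → sym (ℚ.+-inverseʳ (s n))) null-0)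

half-gap : ∀ {ε a b} → ε ℚ.< a → b ℚ.< ½ ℚ.* ε → ½ ℚ.* ε ℚ.< a ℚ.- b
half-gap {ε} {a} {b} ε<a b<½ε = subst (ℚ._< a ℚ.- b)
  (trans (cong (ℚ._- ½ ℚ.* ε) (sym (half+half ε))) (cancel (½ ℚ.* ε)))
  (ℚ.+-mono-< ε<a (ℚ.neg-antimono-< b<½ε))
  where
  open +-*-Solver
  cancel : ∀ a → a ℚ.+ a ℚ.- a ≡ a
  cancel = solve 1 (λ a → a :+ a :- a := a) refl

pos-null : ∀ {s t u} → Pos s → Null t → (∀ n → s n ℚ.- t n ≡ u n) → Pos u
pos-null {t = t} (mkPos ε 0<ε ev) t→0 eq = mkPos (½ ℚ.* ε) (half-pos 0<ε)
  (eventually-zip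
    (λ n ε<s t<½ε → subst (½ ℚ.* ε ℚ.<_) (eq n) (half-gap ε<s (ℚ.≤-<-trans (p≤∣p∣ (t n)) t<½ε)))
    ev (t→0 (½ ℚ.* ε) (half-pos 0<ε)))

-- If y is eventually at most B, then a product above ε forces s above ε / B. This replaces division
-- in the sign arguments below.
pos-cancel : ∀ {s} y → Pos (seq y) → Pos (λ n → s n ℚ.* seq y n) → Pos s
pos-cancel y (mkPos _ 0<η ev) (mkPos ε 0<ε ev′) =
  let B , N , 0<B , y≤B = eventually-bounded (seq y) (cauchy y)
      δ , 0<δ , Bδ≡ε    = quotient B ε 0<B 0<ε
  in mkPos δ 0<δ (eventually-zip
      (λ n η<y (y≤B , ε<xy) → ℚ.≰⇒> λ x≤δ → ℚ.<-irrefl refl (ℚ.<-≤-trans ε<xy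
        (ℚ.≤-trans (ℚ.*-monoʳ-≤-nonNeg (seq y n) {{ℚ.nonNegative (ℚ.<⇒≤ (ℚ.<-trans 0<η η<y))}} x≤δ)
          (subst (δ ℚ.* seq y n ℚ.≤_) (trans (ℚ.*-comm δ B) Bδ≡ε)
            (ℚ.*-monoˡ-≤-nonNeg δ {{ℚ.nonNegative (ℚ.<⇒≤ 0<δ)}} (ℚ.≤-trans (p≤∣p∣ (seq y n)) y≤B))))))
      ev (eventually-zip (λ _ → _,_) (N , y≤B) ev′))

-- A point beyond which a Cauchy sequence stays within ε / 2 decides whether it is eventually positive.
¬pos⇒≤ε : ∀ x → ¬ Pos (seq x) → ∀ ε → 0ℚ ℚ.< ε → Eventually (λ n → seq x n ℚ.< ε)
¬pos⇒≤ε x ¬p ε 0<ε with cauchy x (½ ℚ.* ε) (half-pos 0<ε)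
... | N , close with ½ ℚ.* ε ℚ.<? seq x N
... | no  ≮ = N , λ n N≤n → subst₂ ℚ._<_ (shift (seq x n) (seq x N)) (half+half ε)
    (ℚ.+-mono-<-≤ (ℚ.≤-<-trans (p≤∣p∣ _) (close n N N≤n ℕ.≤-refl)) (ℚ.≮⇒≥ ≮))
  where
  open +-*-Solver
  shift : ∀ a b → (a ℚ.- b) ℚ.+ b ≡ a
  shift = solve 2 (λ a b → (a :- b) :+ b := a) refl
... | yes lt = contradiction
  (mkPos (seq x N ℚ.- ½ ℚ.* ε)
   (subst (ℚ._< seq x N ℚ.- ½ ℚ.* ε) (ℚ.+-inverseʳ (½ ℚ.* ε)) (ℚ.+-monoˡ-< (ℚ.- (½ ℚ.* ε)) lt))
   (N , λ n N≤n → subst₂ ℚ._<_ (swap (seq x n) (seq x N) (½ ℚ.* ε)) (cancel (seq x n) (½ ℚ.* ε))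
     (ℚ.+-monoˡ-< (seq x n ℚ.- ½ ℚ.* ε)
       (ℚ.≤-<-trans (p≤∣p∣ _) (close N n ℕ.≤-refl N≤n))))) ¬p
  where
  open +-*-Solver
  swap : ∀ a b c → (b ℚ.- a) ℚ.+ (a ℚ.- c) ≡ b ℚ.- c
  swap = solve 3 (λ a b c → (b :- a) :+ (a :- c) := b :- c) refl
  cancel : ∀ a c → c ℚ.+ (a ℚ.- c) ≡ a
  cancel = solve 2 (λ a c → c :+ (a :- c) := a) refl

¬neg⇒≥0 : ∀ x → ¬ Pos (seq (- x)) → 0ℝ ≤ x
¬neg⇒≥0 x ¬p ε 0<ε = eventually-map
  (λ n -x<ε → subst (ℚ._< seq x n ℚ.+ ε) (ℚ.+-inverseʳ (seq x n)) (ℚ.+-monoʳ-< (seq x n) -x<ε))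
  (¬pos⇒≤ε (- x) ¬p ε 0<ε)

¬pos⇒null : ∀ x → ¬ Pos (seq x) → ¬ Pos (seq (- x)) → Null (seq x)
¬pos⇒null x ¬p ¬q ε 0<ε = eventually-zip
  (λ n x<ε -x<ε → ∣∣-<ε (seq x n) x<ε -x<ε)
  (¬pos⇒≤ε x ¬p ε 0<ε) (¬pos⇒≤ε (- x) ¬q ε 0<ε)
  where
  ∣∣-<ε : ∀ a → a ℚ.< ε → ℚ.- a ℚ.< ε → ∣ a ∣ ℚ.< ε
  ∣∣-<ε a a<ε -a<ε with ℚ.∣p∣≡p∨∣p∣≡-p a
  ... | inj₁ eq = subst (ℚ._< ε) (sym eq) a<ε
  ... | inj₂ eq = subst (ℚ._< ε) (sym eq) -a<ε

pos-¬pos : ∀ {s} y → Pos s → ¬ Pos (seq y) → Pos (λ n → s n ℚ.- seq y n)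
pos-¬pos y (mkPos ε 0<ε ev) ¬p = mkPos (½ ℚ.* ε) (half-pos 0<ε)
  (eventually-zip (λ _ → half-gap) ev (¬pos⇒≤ε y ¬p (½ ℚ.* ε) (half-pos 0<ε)))

-- The terms are raised to at least ε before inversion, which makes each of them invertible and
-- changes none from index M on.
reciprocal : ∀ x → Pos (seq x) → ∃[ t ] (Pos (seq t) × x * t ≈ 1ℝ)
reciprocal x 0<x@(mkPos ε 0<ε (M , ε<x)) = t , pos-cancel x 0<x 0<t*x , x*t≈1
  where
  open +-*-Solver
  clamp : ℕ → ℚ
  clamp n = ε ℚ.⊔ seq x n

  ε≤clamp : ∀ n → ε ℚ.≤ clamp n
  ε≤clamp n = ℚ.p≤p⊔q ε (seq x n)

  clamp≡ : ∀ n → M ℕ.≤ n → clamp n ≡ seq x n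
  clamp≡ n M≤n = ℚ.p≤q⇒p⊔q≡q (ℚ.<⇒≤ (ε<x n M≤n))

  instance
    ε-pos : ℚ.Positive ε
    ε-pos = ℚ.positive 0<ε
    clamp-pos : ∀ {n} → ℚ.Positive (clamp n)
    clamp-pos {n} = ℚ.positive (ℚ.<-≤-trans 0<ε (ε≤clamp n))
    ε-nonZero : ℚ.NonZero ε
    ε-nonZero = ℚ.pos⇒nonZero ε
    clamp-nonZero : ∀ {n} → ℚ.NonZero (clamp n)
    clamp-nonZero {n} = ℚ.pos⇒nonZero (clamp n)

  inv : ℕ → ℚ
  inv n = ℚ.1/ (clamp n)

  0<inv : ∀ n → 0ℚ ℚ.< inv n
  0<inv n = ℚ.positive⁻¹ (inv n) {{ℚ.1/pos⇒pos (clamp n)}}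

  -- A Lipschitz constant of inversion on the rationals that are at least ε.
  bound : ℚ
  bound = ℚ.1/ ε ℚ.* ℚ.1/ ε

  0<1/ε : 0ℚ ℚ.< ℚ.1/ ε
  0<1/ε = ℚ.positive⁻¹ (ℚ.1/ ε) {{ℚ.1/pos⇒pos ε}}

  inv≤1/ε : ∀ n → inv n ℚ.≤ ℚ.1/ ε
  inv≤1/ε n = ℚ.*-cancelʳ-≤-pos ε (subst (inv n ℚ.* ε ℚ.≤_)
    (trans (ℚ.*-inverseˡ (clamp n)) (sym (ℚ.*-inverseˡ ε)))
    (ℚ.*-monoˡ-≤-nonNeg (inv n) {{ℚ.nonNegative (ℚ.<⇒≤ (0<inv n))}} (ε≤clamp n)))

  inv*inv≤ : ∀ i j → ∣ inv i ℚ.* inv j ∣ ℚ.≤ bound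
  inv*inv≤ i j = subst (ℚ._≤ bound) (sym (ℚ.0≤p⇒∣p∣≡p (ℚ.<⇒≤ (*-pos (0<inv i) (0<inv j)))))
    (ℚ.≤-trans
      (ℚ.*-monoʳ-≤-nonNeg (inv j) {{ℚ.nonNegative (ℚ.<⇒≤ (0<inv j))}} (inv≤1/ε i))
      (ℚ.*-monoˡ-≤-nonNeg (ℚ.1/ ε) {{ℚ.nonNegative (ℚ.<⇒≤ 0<1/ε)}} (inv≤1/ε j)))

  rearrange : ∀ a b c d → (a ℚ.* b) ℚ.* (c ℚ.- d) ≡ a ℚ.* (b ℚ.* c) ℚ.- b ℚ.* (a ℚ.* d)
  rearrange = solve 4 (λ a b c d → (a :* b) :* (c :- d) := a :* (b :* c) :- b :* (a :* d)) refl

  inv-difference : ∀ i j → (inv i ℚ.* inv j) ℚ.* (clamp j ℚ.- clamp i) ≡ inv i ℚ.- inv j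
  inv-difference i j = trans (rearrange (inv i) (inv j) (clamp j) (clamp i)) (cong₂ ℚ._-_
    (trans (cong (inv i ℚ.*_) (ℚ.*-inverseˡ (clamp j))) (ℚ.*-identityʳ (inv i)))
    (trans (cong (inv j ℚ.*_) (ℚ.*-inverseˡ (clamp i))) (ℚ.*-identityʳ (inv j))))

  inv-cauchy : IsCauchy inv
  inv-cauchy η 0<η =
    let δ , 0<δ , eq = quotient bound η (*-pos 0<1/ε 0<1/ε) 0<η
        N , close    = cauchy x δ 0<δ
    in M ℕ.⊔ N , λ i j l l′ → subst₂ ℚ._<_ (cong ∣_∣ (inv-difference i j)) eq
         (∣*∣-< (inv i ℚ.* inv j) (clamp j ℚ.- clamp i) (*-pos 0<1/ε 0<1/ε) (inv*inv≤ i j)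
           (subst₂ (λ a b → ∣ a ℚ.- b ∣ ℚ.< δ)
             (sym (clamp≡ j (ℕ.m⊔n≤o⇒m≤o M N l′))) (sym (clamp≡ i (ℕ.m⊔n≤o⇒m≤o M N l)))
             (close j i (ℕ.m⊔n≤o⇒n≤o M N l′) (ℕ.m⊔n≤o⇒n≤o M N l))))

  t : ℝ
  t = mkℝ inv inv-cauchy

  x*t≈1 : x * t ≈ 1ℝ
  x*t≈1 η 0<η = M , λ n M≤n → subst (λ a → ∣ a ℚ.- 1ℚ ∣ ℚ.< η)
    (sym (trans (cong (ℚ._* inv n) (sym (clamp≡ n M≤n))) (ℚ.*-inverseʳ (clamp n)))) 0<η

  0<t*x : Pos (seq (t * x))
  0<t*x = pos-null {t = λ n → ℚ.- (seq x n ℚ.* inv n ℚ.- 1ℚ)}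
    (pos-fromℚ (ℚ.positive⁻¹ 1ℚ))
    (null-neg {λ n → seq x n ℚ.* inv n ℚ.- 1ℚ} x*t≈1)
    (λ n → cancel (seq x n) (inv n) 1ℚ)
    where
    cancel : ∀ a b c → c ℚ.- (ℚ.- (a ℚ.* b ℚ.- c)) ≡ b ℚ.* a
    cancel = solve 3 (λ a b c → c :- (:- (a :* b :- c)) := b :* a) refl

-- Planar vectors and convex hulls

infix 8 _⟶_
infix 7 _·_ _∧_

_⟶_ : Point → Point → Point
(x , y) ⟶ (x′ , y′) = x′ - x , y′ - y

_·_ _∧_ : Point → Point → ℝ
(x , y) · (x′ , y′) = x * x′ + y * y′
(x , y) ∧ (x′ , y′) = x * y′ - y * x′

-- Twice the signed area of the triangle, positive for a left turn.
orient : Point → Point → Point → ℝ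
orient p q r = (p ⟶ q) ∧ (p ⟶ r)

-- A positive witness of distinctness; for points that are merely not `≈ₚ` it is available only up
-- to double negation.
Apart : Point → Point → Set
Apart p q = Pos (seq ((p ⟶ q) · (p ⟶ q)))

Left Acute : Point → Point → Point → Set
Left p q r  = Pos (seq (orient p q r))
Acute p q r = Pos (seq ((q ⟶ p) · (q ⟶ r)))

open +-*-Solver

_ₓ _ᵧ : Point → ℕ → ℚ
(p ₓ) n = seq (proj₁ p) n
(p ᵧ) n = seq (proj₂ p) n

infix 9 _ₓ _ᵧ

-- By the addition formula for the sine, `(v · v)(u ∧ w) = (u ∧ v)(v · w) + (u · v)(v ∧ w)`. Two
-- left turns by more than a right angle each turn by more than π together.
pos-turn : ∀ u v w → Pos (seq (v · v)) → Pos (seq (u ∧ v)) → Pos (seq (v ∧ w)) →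
  Pos (seq (- (u · v))) → Pos (seq (- (v · w))) → Pos (seq (- (u ∧ w)))
pos-turn u v w v≠0 uv vw u·v v·w = pos-cancel (v · v) v≠0
  (pos-resp (λ n → identity ((u ₓ) n) ((u ᵧ) n) ((v ₓ) n) ((v ᵧ) n) ((w ₓ) n) ((w ᵧ) n))
    (pos-+ (pos-* uv v·w) (pos-* u·v vw)))
  where
  identity : ∀ a b c d e f →
    (a ℚ.* d ℚ.- b ℚ.* c) ℚ.* (ℚ.- (c ℚ.* e ℚ.+ d ℚ.* f)) ℚ.+ (ℚ.- (a ℚ.* c ℚ.+ b ℚ.* d)) ℚ.* (c ℚ.* f ℚ.- d ℚ.* e)
    ≡ (ℚ.- (a ℚ.* f ℚ.- b ℚ.* e)) ℚ.* (c ℚ.* c ℚ.+ d ℚ.* d)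
  identity = solve 6 (λ a b c d e f →
    (a :* d :- b :* c) :* (:- (c :* e :+ d :* f)) :+ (:- (a :* c :+ b :* d)) :* (c :* f :- d :* e)
    := (:- (a :* f :- b :* e)) :* (c :* c :+ d :* d)) refl

-- The vector v lies inside the acute angle from u to w. In `(u · v)(u ∧ w) = (u · w)(u ∧ v) + (u ·
-- u)(v ∧ w)` the right side is positive.
pos-between : ∀ u v w → Pos (seq (u · u)) → Pos (seq (u ∧ v)) → Pos (seq (v ∧ w)) → Pos (seq (u ∧ w)) →
  Pos (seq (u · w)) → Pos (seq (u · v))
pos-between u v w u≠0 uv vw uw u·w = pos-cancel (u ∧ w) uw
  (pos-resp (λ n → identity ((u ₓ) n) ((u ᵧ) n) ((v ₓ) n) ((v ᵧ) n) ((w ₓ) n) ((w ᵧ) n))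
    (pos-+ (pos-* u·w uv) (pos-* u≠0 vw)))
  where
  identity : ∀ a b c d e f →
    (a ℚ.* e ℚ.+ b ℚ.* f) ℚ.* (a ℚ.* d ℚ.- b ℚ.* c) ℚ.+ (a ℚ.* a ℚ.+ b ℚ.* b) ℚ.* (c ℚ.* f ℚ.- d ℚ.* e)
    ≡ (a ℚ.* c ℚ.+ b ℚ.* d) ℚ.* (a ℚ.* f ℚ.- b ℚ.* e)
  identity = solve 6 (λ a b c d e f →
    (a :* e :+ b :* f) :* (a :* d :- b :* c) :+ (a :* a :+ b :* b) :* (c :* f :- d :* e)
    := (a :* c :+ b :* d) :* (a :* f :- b :* e)) refl

-- Exchanging the coordinates is a reflection: it preserves scalar products and reverses
-- orientation.
pos-between′ : ∀ u v w → Pos (seq (u · u)) → Pos (seq (w ∧ v)) → Pos (seq (v ∧ u)) → Pos (seq (w ∧ u)) →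
  Pos (seq (u · w)) → Pos (seq (u · v))
pos-between′ u v w u≠0 wv vu wu u·w = pos-resp (·-mirror u v) (pos-between (mirror u) (mirror v) (mirror w)
  (pos-resp (λ n → sym (·-mirror u u n)) u≠0)
  (pos-resp (∧-mirror v u) vu) (pos-resp (∧-mirror w v) wv) (pos-resp (∧-mirror w u) wu)
  (pos-resp (λ n → sym (·-mirror u w n)) u·w))
  where
  mirror : Point → Point
  mirror (x , y) = y , x
  ·-mirror : ∀ u v n → seq (mirror u · mirror v) n ≡ seq (u · v) n
  ·-mirror u v n = ℚ.+-comm ((u ᵧ) n ℚ.* (v ᵧ) n) ((u ₓ) n ℚ.* (v ₓ) n)
  ∧-mirror : ∀ u v n → seq (u ∧ v) n ≡ seq (mirror v ∧ mirror u) n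
  ∧-mirror u v n = solve 4 (λ a b c d → a :* d :- b :* c := d :* a :- c :* b) refl
    ((u ₓ) n) ((u ᵧ) n) ((v ₓ) n) ((v ᵧ) n)

·-comm : ∀ u v n → seq (u · v) n ≡ seq (v · u) n
·-comm u v n = solve 4 (λ a b c d → a :* c :+ b :* d := c :* a :+ d :* b) refl
  ((u ₓ) n) ((u ᵧ) n) ((v ₓ) n) ((v ᵧ) n)

∧-anticomm : ∀ u v n → ℚ.- seq (u ∧ v) n ≡ seq (v ∧ u) n
∧-anticomm u v n = solve 4 (λ a b c d → :- (a :* d :- b :* c) := c :* b :- d :* a) refl
  ((u ₓ) n) ((u ᵧ) n) ((v ₓ) n) ((v ᵧ) n)

orient-rotate : ∀ p q r n → seq (orient p q r) n ≡ seq (orient q r p) n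
orient-rotate p q r n = solve 6 (λ a b c d e f →
    (c :- a) :* (f :- b) :- (d :- b) :* (e :- a) := (e :- c) :* (b :- d) :- (f :- d) :* (a :- c)) refl
  ((p ₓ) n) ((p ᵧ) n) ((q ₓ) n) ((q ᵧ) n) ((r ₓ) n) ((r ᵧ) n)

orient-∧ : ∀ p q r n → seq (orient p q r) n ≡ seq ((p ⟶ q) ∧ (q ⟶ r)) n
orient-∧ p q r n = solve 6 (λ a b c d e f →
    (c :- a) :* (f :- b) :- (d :- b) :* (e :- a) := (c :- a) :* (f :- d) :- (d :- b) :* (e :- c)) refl
  ((p ₓ) n) ((p ᵧ) n) ((q ₓ) n) ((q ᵧ) n) ((r ₓ) n) ((r ᵧ) n)

·-reverseˡ : ∀ p q v n → seq ((q ⟶ p) · v) n ≡ seq (- ((p ⟶ q) · v)) n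
·-reverseˡ p q v n = solve 6 (λ a b c d e f →
    (a :- c) :* e :+ (b :- d) :* f := :- ((c :- a) :* e :+ (d :- b) :* f)) refl
  ((p ₓ) n) ((p ᵧ) n) ((q ₓ) n) ((q ᵧ) n) ((v ₓ) n) ((v ᵧ) n)

acute-sym : ∀ p q r → Acute p q r → Acute r q p
acute-sym p q r = pos-resp (·-comm (q ⟶ p) (q ⟶ r))

turn>π : ∀ p q r s → Apart q r → Left p q r → Left q r s →
  Acute p q r → Acute q r s → Pos (seq (- ((p ⟶ q) ∧ (r ⟶ s))))
turn>π p q r s q≠r pqr qrs ∠q ∠r = pos-turn (p ⟶ q) (q ⟶ r) (r ⟶ s) q≠r
  (pos-resp (orient-∧ p q r) pqr) (pos-resp (orient-∧ q r s) qrs)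
  (pos-resp (·-reverseˡ p q (q ⟶ r)) ∠q) (pos-resp (·-reverseˡ q r (r ⟶ s)) ∠r)

-- The acute angles at q and r make `(p ⟶ q) ∧ (r ⟶ s)` negative, those at s and p make it positive.
¬-four-acute-angles : ∀ p q r s → Apart q r → Apart s p →
  Left p q r → Left q r s → Left r s p → Left s p q →
  Acute p q r → Acute q r s → Acute r s p → Acute s p q → ⊥
¬-four-acute-angles p q r s q≠r s≠p pqr qrs rsp spq ∠q ∠r ∠s ∠p = pos-asym
  (turn>π p q r s q≠r pqr qrs ∠q ∠r)
  (pos-resp (λ n → cong ℚ.-_ (sym (∧-anticomm (p ⟶ q) (r ⟶ s) n))) (turn>π r s p q s≠p rsp spq ∠s ∠p))

-- By the law of cosines the scalar product at q is half of |pq|² + |qb|² - |pb|², and the last two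
-- terms cancel up to a null sequence.
isosceles-acute : ∀ p q b → Apart q p → IsDistance p b 1ℝ → IsDistance q b 1ℝ → Acute p q b
isosceles-acute p q b q≠p (_ , pb) (_ , qb) = pos-null
  (pos-* (pos-fromℚ (ℚ.positive⁻¹ ½)) q≠p)
  (null-* (fromℚ ½) {λ n → gap q n ℚ.+ (ℚ.- gap p n)} (null-+ {gap q} qb (null-neg {gap p} pb)))
  (λ n → identity ((p ₓ) n) ((p ᵧ) n) ((q ₓ) n) ((q ᵧ) n) ((b ₓ) n) ((b ᵧ) n) (1ℚ ℚ.* 1ℚ))
  where
  gap : Point → ℕ → ℚ
  gap (x , y) n = seq (1ℝ * 1ℝ) n ℚ.- seq ((x - proj₁ b) * (x - proj₁ b) + (y - proj₂ b) * (y - proj₂ b)) n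
  identity : ∀ a b c d e f o →
    ½ ℚ.* ((a ℚ.- c) ℚ.* (a ℚ.- c) ℚ.+ (b ℚ.- d) ℚ.* (b ℚ.- d))
      ℚ.- ½ ℚ.* ((o ℚ.- ((c ℚ.- e) ℚ.* (c ℚ.- e) ℚ.+ (d ℚ.- f) ℚ.* (d ℚ.- f)))
        ℚ.+ (ℚ.- (o ℚ.- ((a ℚ.- e) ℚ.* (a ℚ.- e) ℚ.+ (b ℚ.- f) ℚ.* (b ℚ.- f)))))
    ≡ (a ℚ.- c) ℚ.* (e ℚ.- c) ℚ.+ (b ℚ.- d) ℚ.* (f ℚ.- d)
  identity = solve 7 (λ a b c d e f o →
    con ½ :* ((a :- c) :* (a :- c) :+ (b :- d) :* (b :- d))
      :- con ½ :* ((o :- ((c :- e) :* (c :- e) :+ (d :- f) :* (d :- f)))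
        :+ (:- (o :- ((a :- e) :* (a :- e) :+ (b :- f) :* (b :- f)))))
    := (a :- c) :* (e :- c) :+ (b :- d) :* (f :- d)) refl

-- Membership in convex hulls of three points.

weighted-mean : ∀ x a b c l m k t →
  Null (seq (l * (a - x) + m * (b - x) + k * (c - x))) → (l + m + k) * t ≈ 1ℝ →
  Null (λ n → seq x n ℚ.- (seq l n ℚ.* seq t n ℚ.* seq a n ℚ.+
    (seq m n ℚ.* seq t n ℚ.* seq b n ℚ.+ (seq k n ℚ.* seq t n ℚ.* seq c n ℚ.+ 0ℚ))))
-- The difference is minus the sum of t times the vanishing combination and x times
-- `(l + m + k) * t - 1`.
weighted-mean x a b c l m k t comb→0 St≈1 = null-resp
  (λ n → identity (seq x n) (seq a n) (seq b n) (seq c n) (seq l n) (seq m n) (seq k n) (seq t n))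
  (null-neg {λ n → seq t n ℚ.* seq comb n ℚ.+ seq x n ℚ.* (seq ((l + m + k) * t) n ℚ.- 1ℚ)}
    (null-+ {λ n → seq t n ℚ.* seq comb n} (null-* t {seq comb} comb→0)
      (null-* x {λ n → seq ((l + m + k) * t) n ℚ.- 1ℚ} St≈1)))
  where
  comb = l * (a - x) + m * (b - x) + k * (c - x)
  identity : ∀ x a b c l m k t →
    ℚ.- (t ℚ.* (l ℚ.* (a ℚ.- x) ℚ.+ m ℚ.* (b ℚ.- x) ℚ.+ k ℚ.* (c ℚ.- x)) ℚ.+ x ℚ.* ((l ℚ.+ m ℚ.+ k) ℚ.* t ℚ.- 1ℚ))
    ≡ x ℚ.- (l ℚ.* t ℚ.* a ℚ.+ (m ℚ.* t ℚ.* b ℚ.+ (k ℚ.* t ℚ.* c ℚ.+ 0ℚ)))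
  identity = solve 8 (λ x a b c l m k t →
    :- (t :* (l :* (a :- x) :+ m :* (b :- x) :+ k :* (c :- x)) :+ x :* ((l :+ m :+ k) :* t :- con 1ℚ))
    := x :- (l :* t :* a :+ (m :* t :* b :+ (k :* t :* c :+ con 0ℚ)))) refl

-- The definition of `ConvexHull` with `sum` unfolded, trailing zero included, so that termwise
-- identities can meet its conditions.
hull-of-three : ∀ (S : Point → Set) x (q : Vector Point 3) (w : Vector ℝ 3) →
  (let w₀ = w zero; w₁ = w (suc zero); w₂ = w (suc (suc zero))
       q₀ = q zero; q₁ = q (suc zero); q₂ = q (suc (suc zero))) →
  (∀ i → S (q i)) → (∀ i → 0ℝ ≤ w i) →
  Null (λ n → seq w₀ n ℚ.+ (seq w₁ n ℚ.+ (seq w₂ n ℚ.+ 0ℚ)) ℚ.- 1ℚ) →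
  Null (λ n → (x ₓ) n ℚ.- (seq w₀ n ℚ.* (q₀ ₓ) n ℚ.+ (seq w₁ n ℚ.* (q₁ ₓ) n ℚ.+ (seq w₂ n ℚ.* (q₂ ₓ) n ℚ.+ 0ℚ)))) →
  Null (λ n → (x ᵧ) n ℚ.- (seq w₀ n ℚ.* (q₀ ᵧ) n ℚ.+ (seq w₁ n ℚ.* (q₁ ᵧ) n ℚ.+ (seq w₂ n ℚ.* (q₂ ᵧ) n ℚ.+ 0ℚ)))) →
  ConvexHull S x
hull-of-three S x q w Sq w≥0 Σw≈1 x≈ y≈ = 3 , w , q , Sq , w≥0 , Σw≈1 , x≈ , y≈

-- The coefficients are normalised by the reciprocal t of their sum.
convex-combination : ∀ (S : Point → Set) x a b c l m k → S a → S b → S c →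
  ¬ Pos (seq (- l)) → ¬ Pos (seq (- m)) → ¬ Pos (seq (- k)) → Pos (seq (l + m + k)) →
  Null (seq (l * proj₁ (x ⟶ a) + m * proj₁ (x ⟶ b) + k * proj₁ (x ⟶ c))) →
  Null (seq (l * proj₂ (x ⟶ a) + m * proj₂ (x ⟶ b) + k * proj₂ (x ⟶ c))) →
  ConvexHull S x
convex-combination S x a b c l m k Sa Sb Sc l≥0 m≥0 k≥0 S>0 eqₓ eqᵧ =
  hull-of-three S x (a ∷ b ∷ c ∷ []) weight members weight≥0 Σweight≈1
  (weighted-mean (proj₁ x) (proj₁ a) (proj₁ b) (proj₁ c) l m k t eqₓ St≈1)
  (weighted-mean (proj₂ x) (proj₂ a) (proj₂ b) (proj₂ c) l m k t eqᵧ St≈1)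
  where
  inverse = reciprocal (l + m + k) S>0
  t    = proj₁ inverse
  t>0  = proj₁ (proj₂ inverse)
  St≈1 = proj₂ (proj₂ inverse)

  weight : Vector ℝ 3
  weight i = (l ∷ m ∷ k ∷ []) i * t

  members : ∀ i → S ((a ∷ b ∷ c ∷ []) i)
  members zero             = Sa
  members (suc zero)       = Sb
  members (suc (suc zero)) = Sc

  coefficient≥0 : ∀ i → ¬ Pos (seq (- (l ∷ m ∷ k ∷ []) i))
  coefficient≥0 zero             = l≥0
  coefficient≥0 (suc zero)       = m≥0
  coefficient≥0 (suc (suc zero)) = k≥0

  weight≥0 : ∀ i → 0ℝ ≤ weight i
  weight≥0 i = ¬neg⇒≥0 (weight i) λ p → coefficient≥0 i (pos-cancel t t>0
    (pos-resp (λ n → ℚ.neg-distribˡ-* (seq ((l ∷ m ∷ k ∷ []) i) n) (seq t n)) p))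

  Σweight≈1 : Null (λ n → seq l n ℚ.* seq t n ℚ.+ (seq m n ℚ.* seq t n ℚ.+ (seq k n ℚ.* seq t n ℚ.+ 0ℚ)) ℚ.- 1ℚ)
  Σweight≈1 = null-resp {λ n → (seq l n ℚ.+ seq m n ℚ.+ seq k n) ℚ.* seq t n ℚ.- 1ℚ} (λ n → cong (ℚ._- 1ℚ) (solve 4
    (λ l m k t → (l :+ m :+ k) :* t := l :* t :+ (m :* t :+ (k :* t :+ con 0ℚ))) refl
    (seq l n) (seq m n) (seq k n) (seq t n))) St≈1

-- The coefficients are barycentric coordinates, that is, areas of the triangles at x:
-- `(v ∧ w) u + (w ∧ u) v + (u ∧ v) w` vanishes identically in the plane.
in-triangle : ∀ (S : Point → Set) x a b c → S a → S b → S c →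
  Left x b c → Left x c a → Left x a b → ConvexHull S x
in-triangle S x a b c Sa Sb Sc xbc xca xab = convex-combination S x a b c (v ∧ w) (w ∧ u) (u ∧ v) Sa Sb Sc
  (pos-asym xbc) (pos-asym xca) (pos-asym xab) (pos-+ (pos-+ xbc xca) xab)
  (null-resp (λ n → solve 6 (λ a b c d e f →
      con 0ℚ := (c :* f :- d :* e) :* a :+ (e :* b :- f :* a) :* c :+ (a :* d :- b :* c) :* e) refl
    ((u ₓ) n) ((u ᵧ) n) ((v ₓ) n) ((v ᵧ) n) ((w ₓ) n) ((w ᵧ) n)) null-0)
  (null-resp (λ n → solve 6 (λ a b c d e f →
      con 0ℚ := (c :* f :- d :* e) :* b :+ (e :* b :- f :* a) :* d :+ (a :* d :- b :* c) :* f) refl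
    ((u ₓ) n) ((u ᵧ) n) ((v ₓ) n) ((v ᵧ) n) ((w ₓ) n) ((w ᵧ) n)) null-0)
  where
  u = x ⟶ a
  v = x ⟶ b
  w = x ⟶ c

-- Projecting u on v leaves a multiple of u ∧ v, so (v · v) u - (u · v) v vanishes.
in-segment : ∀ (S : Point → Set) x a b → S a → S b → Apart x b →
  Null (seq (orient x a b)) → ¬ Acute a x b → ConvexHull S x
in-segment S x a b Sa Sb x≠b collinear obtuse = convex-combination S x a b a (v · v) (- (u · v)) 0ℝ Sa Sb Sa
  (pos-asym x≠b)
  (λ p → obtuse (pos-resp (λ n → neg-neg (seq (u · v) n)) p))
  (λ p → pos-¬null p null-0)
  (pos-resp (λ n → sym (ℚ.+-identityʳ _)) (pos-¬pos (u · v) x≠b obtuse))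
  (null-resp (λ n → solve 4 (λ a b c d →
      d :* (a :* d :- b :* c) :=
      (c :* c :+ d :* d) :* a :+ (:- (a :* c :+ b :* d)) :* c :+ con 0ℚ :* a) refl
    ((u ₓ) n) ((u ᵧ) n) ((v ₓ) n) ((v ᵧ) n))
    (null-* (proj₂ v) {seq (orient x a b)} collinear))
  (null-resp (λ n → solve 4 (λ a b c d →
      (:- c) :* (a :* d :- b :* c) :=
      (c :* c :+ d :* d) :* b :+ (:- (a :* c :+ b :* d)) :* d :+ con 0ℚ :* b) refl
    ((u ₓ) n) ((u ᵧ) n) ((v ₓ) n) ((v ᵧ) n))
    (null-* (- proj₁ v) {seq (orient x a b)} collinear))
  where
  u = x ⟶ a
  v = x ⟶ b
  neg-neg : ∀ a → ℚ.- (ℚ.- a) ≡ a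
  neg-neg = solve 1 (λ a → :- (:- a) := a) refl

-- With u = a - x and v = b - x the three scalar products are u · v, u · u - u · v and
-- v · v - u · v, and (u · u)(v · v) = (u · v)² for parallel vectors.
¬-collinear-acute : ∀ x a b → Null (seq (orient x a b)) →
  Acute a x b → Acute x a b → Acute x b a → ⊥
¬-collinear-acute x a b collinear ∠x ∠a ∠b = pos-¬null
  (pos-+ (pos-+ (pos-* ∠a ∠b) (pos-* ∠x ∠a)) (pos-* ∠x ∠b))
  (null-resp (λ n → trans
      (solve 4 (λ a b c d →
        (a :* d :- b :* c) :* (a :* d :- b :* c) :=
        (a :* a :+ b :* b :- (a :* c :+ b :* d)) :* (c :* c :+ d :* d :- (a :* c :+ b :* d))
        :+ (a :* c :+ b :* d) :* (a :* a :+ b :* b :- (a :* c :+ b :* d))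
        :+ (a :* c :+ b :* d) :* (c :* c :+ d :* d :- (a :* c :+ b :* d))) refl
      ((u ₓ) n) ((u ᵧ) n) ((v ₓ) n) ((v ᵧ) n))
      (cong₂ (λ α β → α ℚ.* β ℚ.+ seq (u · v) n ℚ.* α ℚ.+ seq (u · v) n ℚ.* β)
        (shift ((x ₓ) n) ((x ᵧ) n) ((a ₓ) n) ((a ᵧ) n) ((b ₓ) n) ((b ᵧ) n))
        (trans (cong (λ r → seq (v · v) n ℚ.- r) (·-comm u v n))
          (shift ((x ₓ) n) ((x ᵧ) n) ((b ₓ) n) ((b ᵧ) n) ((a ₓ) n) ((a ᵧ) n)))))
    (null-* (orient x a b) {seq (orient x a b)} collinear))
  where
  u = x ⟶ a
  v = x ⟶ b
  shift : ∀ x y a b c d →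
    (a ℚ.- x) ℚ.* (a ℚ.- x) ℚ.+ (b ℚ.- y) ℚ.* (b ℚ.- y) ℚ.- ((a ℚ.- x) ℚ.* (c ℚ.- x) ℚ.+ (b ℚ.- y) ℚ.* (d ℚ.- y))
    ≡ (x ℚ.- a) ℚ.* (c ℚ.- a) ℚ.+ (y ℚ.- b) ℚ.* (d ℚ.- b)
  shift = solve 6 (λ x y a b c d →
    (a :- x) :* (a :- x) :+ (b :- y) :* (b :- y) :- ((a :- x) :* (c :- x) :+ (b :- y) :* (d :- y))
    := (x :- a) :* (c :- a) :+ (y :- b) :* (d :- b)) refl

-- A coordinate difference of either sign would make the squared distance positive.
¬apart⇒≈ : ∀ p q → ¬ Apart p q → q ≈ₚ p
¬apart⇒≈ p q ¬p =
  ¬pos⇒null x (λ r → ¬p (square-pos x y r)) (λ r → ¬p (pos-resp neg² (square-pos (- x) y r))) ,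
  ¬pos⇒null y (λ r → ¬p (pos-resp swap (square-pos y x r)))
    (λ r → ¬p (pos-resp (λ n → trans (neg²′ n) (swap n)) (square-pos (- y) x r)))
  where
  x = proj₁ (p ⟶ q)
  y = proj₂ (p ⟶ q)
  square-pos : ∀ x y → Pos (seq x) → Pos (seq (x * x + y * y))
  square-pos x y x>0 = pos-resp (λ n → neg-neg (seq x n ℚ.* seq x n) (seq y n ℚ.* seq y n))
    (pos-¬pos (- (y * y)) (pos-* x>0 x>0) λ (mkPos ε 0<ε (N , f)) →
      ℚ.<-irrefl refl (ℚ.<-trans 0<ε (ℚ.<-≤-trans (f N ℕ.≤-refl) (ℚ.neg-antimono-≤ (0≤p*p (seq y N))))))
    where
    neg-neg : ∀ a b → a ℚ.- (ℚ.- b) ≡ a ℚ.+ b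
    neg-neg = solve 2 (λ a b → a :- (:- b) := a :+ b) refl
  neg²+ : ∀ a b → (ℚ.- a) ℚ.* (ℚ.- a) ℚ.+ b ℚ.* b ≡ a ℚ.* a ℚ.+ b ℚ.* b
  neg²+ = solve 2 (λ a b → (:- a) :* (:- a) :+ b :* b := a :* a :+ b :* b) refl
  neg² : ∀ n → seq (- x * - x + y * y) n ≡ seq (x * x + y * y) n
  neg² n = neg²+ (seq x n) (seq y n)
  neg²′ : ∀ n → seq (- y * - y + x * x) n ≡ seq (y * y + x * x) n
  neg²′ n = neg²+ (seq y n) (seq x n)
  swap : ∀ n → seq (y * y + x * x) n ≡ seq (x * x + y * y) n
  swap n = ℚ.+-comm (seq (y * y) n) (seq (x * x) n)

-- Points in convex position

module ConvexPosition {n : ℕ} (P : PointSet n) (independent : ConvexlyIndependent P) where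

  Left′ Acute′ : Fin n → Fin n → Fin n → Set
  Left′ i j k  = Left (point P i) (point P j) (point P k)
  Acute′ i j k = Acute (point P i) (point P j) (point P k)

  Apart′ Unit : Fin n → Fin n → Set
  Apart′ i j = Apart (point P i) (point P j)
  Unit       = Adjacent (unitDistanceGraph P)

  Other : Fin n → Point → Set
  Other i q = q ∈ P × ¬ q ≈ₚ point P i

  other : ∀ {i j} → i ≢ j → Other i (point P j)
  other {i} {j} i≢j = (j , ≈ₚ-refl (point P j)) , λ eq → i≢j (sym (distinct P eq))

  ¬hull : ∀ i → ¬ ConvexHull (Other i) (point P i)
  ¬hull i = independent (point P i) (i , ≈ₚ-refl (point P i))

  apart : ∀ i j → i ≢ j → ¬ ¬ Apart′ i j
  apart i j i≢j ¬a = i≢j (sym (distinct P (¬apart⇒≈ (point P i) (point P j) ¬a)))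

  left-rotate : ∀ {i j k} → Left′ i j k → Left′ j k i
  left-rotate {i} {j} {k} = pos-resp (orient-rotate (point P i) (point P j) (point P k))

  left-asym : ∀ {i j k} → Left′ i j k → ¬ Left′ i k j
  left-asym {i} {j} {k} ijk ikj = pos-asym ijk
    (pos-resp (λ n → sym (∧-anticomm (point P i ⟶ point P j) (point P i ⟶ point P k) n)) ikj)

  left⇒≢ : ∀ {i j k} → Left′ i j k → i ≢ j
  left⇒≢ {i} {j} {k} ijk refl = left-asym {k} {i} {i} kii kii
    where kii = left-rotate {i} {k} {i} (left-rotate {i} {i} {k} ijk)

  ¬left-triangle : ∀ {x a b c} → Left′ x a b → Left′ x b c → ¬ Left′ x c a
  ¬left-triangle {x} {a} {b} {c} xab xbc xca = ¬hull x
    (in-triangle (Other x) (point P x) (point P a) (point P b) (point P c)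
      (other x≢a) (other x≢b) (other x≢c) xbc xca xab)
    where
    x≢a : x ≢ a
    x≢a = left⇒≢ {x} {a} {b} xab
    x≢b : x ≢ b
    x≢b = left⇒≢ {x} {b} {c} xbc
    x≢c : x ≢ c
    x≢c = left⇒≢ {x} {c} {a} xca

  -- Otherwise point i would lie on the segment between the two others, against convex independence.
  acute-if-collinear : ∀ {i j k} → i ≢ j → i ≢ k →
    Null (seq (orient (point P i) (point P j) (point P k))) → ¬ ¬ Acute′ j i k
  acute-if-collinear {i} {j} {k} i≢j i≢k collinear obtuse = apart i k i≢k λ ik →
    ¬hull i (in-segment (Other i) (point P i) (point P j) (point P k) (other i≢j) (other i≢k) ik collinear obtuse)

  -- If neither orientation holds, the points are collinear, and each of them sees the other two in
  -- the same direction. No three collinear points do so.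
  left-total : ∀ i j k → i ≢ j → i ≢ k → j ≢ k → ¬ ¬ (Left′ i j k ⊎ Left′ i k j)
  left-total i j k i≢j i≢k j≢k neither =
    acute-if-collinear i≢j i≢k ijk λ ∠i →
    acute-if-collinear (i≢j ∘ sym) j≢k jik λ ∠j →
    acute-if-collinear (i≢k ∘ sym) (j≢k ∘ sym) kij λ ∠k →
    ¬-collinear-acute (point P i) (point P j) (point P k) ijk ∠i ∠j ∠k
    where
    pᵢ = point P i
    pⱼ = point P j
    pₖ = point P k
    ijk : Null (seq (orient pᵢ pⱼ pₖ))
    ijk = ¬pos⇒null (orient pᵢ pⱼ pₖ) (neither ∘ inj₁)
      (neither ∘ inj₂ ∘ pos-resp (∧-anticomm (pᵢ ⟶ pⱼ) (pᵢ ⟶ pₖ)))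
    ikj : Null (seq (orient pᵢ pₖ pⱼ))
    ikj = null-resp (∧-anticomm (pᵢ ⟶ pⱼ) (pᵢ ⟶ pₖ)) (null-neg {seq (orient pᵢ pⱼ pₖ)} ijk)
    jik : Null (seq (orient pⱼ pᵢ pₖ))
    jik = null-resp (λ n → sym (orient-rotate pⱼ pᵢ pₖ n)) ikj
    kij : Null (seq (orient pₖ pᵢ pⱼ))
    kij = null-resp (λ n → sym (orient-rotate pₖ pᵢ pⱼ n)) ijk

-- Every sign used below is known up to double negation only, which is enough
-- because the bound itself is an inequality between natural numbers.
module EdgeBound {m : ℕ} (P : PointSet (suc m)) (independent : ConvexlyIndependent P) where
  open ConvexPosition P independent

  module _ (total : ∀ i j k → i ≢ j → i ≢ k → j ≢ k → Left′ i j k ⊎ Left′ i k j)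
           (separated : ∀ i j → i ≢ j → Apart′ i j) where

    isosceles : ∀ {p q b} → p ≢ q → Unit p b → Unit q b → Acute′ p q b
    isosceles {p} {q} {b} p≢q = isosceles-acute (point P p) (point P q) (point P b) (separated q p (p≢q ∘ sym))

    acute-swap : ∀ {p q r} → Acute′ p q r → Acute′ r q p
    acute-swap {p} {q} {r} = acute-sym (point P p) (point P q) (point P r)

    shrinkˡ : ∀ {p q b y} → Left′ q b y → Left′ q y p → Left′ q b p → Acute′ p q b → Acute′ y q b
    shrinkˡ {p} {q} {b} {y} qby qyp qbp ∠q = acute-swap {b} {q} {y}
      (pos-between (point P q ⟶ point P b) (point P q ⟶ point P y) (point P q ⟶ point P p)
        (separated q b (left⇒≢ {q} {b} {y} qby)) qby qyp qbp (acute-swap {p} {q} {b} ∠q))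

    shrinkʳ : ∀ {q b c x} → Left′ b c x → Left′ b x q → Left′ b c q → Acute′ q b c → Acute′ q b x
    shrinkʳ {q} {b} {c} {x} bcx bxq bcq =
      pos-between′ (point P b ⟶ point P q) (point P b ⟶ point P x) (point P b ⟶ point P c)
        (separated b q (left⇒≢ {q} {b} {x} (left-rotate {x} {q} {b} (left-rotate {b} {x} {q} bxq)) ∘ sym))
        bcx bxq bcq

    ¬-four-acute : ∀ {p q r s} → Left′ p q r → Left′ q r s → Left′ r s p → Left′ s p q →
      Acute′ p q r → Acute′ q r s → Acute′ r s p → Acute′ s p q → ⊥
    ¬-four-acute {p} {q} {r} {s} pqr qrs rsp spq =
      ¬-four-acute-angles (point P p) (point P q) (point P r) (point P s)
        (separated q r (left⇒≢ {q} {r} {s} qrs)) (separated s p (left⇒≢ {s} {p} {q} spq)) pqr qrs rsp spq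

    edges≤ : ∀ es → Unique es → All (IsEdge (unitDistanceGraph P)) es → 
      ¬ ¬ (length es ℕ.≤ suc m ℕ.* suc ⌊log₂ suc m ⌋ ℕ.+ (suc m ℕ.* suc ⌊log₂ suc m ⌋ ℕ.+ suc m))
    edges≤ es unique all = ConvexOrientation.UnitEdges.edges≤bound Left′
      (λ {i} {j} {k} → left-rotate {i} {j} {k}) (λ {i} {j} {k} → left-asym {i} {j} {k})
      total (λ {x} {a} {b} {c} → ¬left-triangle {x} {a} {b} {c}) Unit Acute′
      (λ {p} {q} {b} → isosceles {p} {q} {b}) (λ {p} {q} {r} → acute-swap {p} {q} {r})
      (λ {p} {q} → symmetric (unitDistanceGraph P) {p} {q})
      (λ {p} {q} {b} {y} → shrinkˡ {p} {q} {b} {y}) (λ {q} {b} {c} {x} → shrinkʳ {q} {b} {c} {x})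
      (λ {p} {q} {r} {s} → ¬-four-acute {p} {q} {r} {s})
      (λ {p} {b} pb p≡b → irreflexive (unitDistanceGraph P) p≡b pb)
      es unique all

  edges≤bound : ∀ es → Unique es → All (IsEdge (unitDistanceGraph P)) es →
    length es ℕ.≤ suc m ℕ.* suc ⌊log₂ suc m ⌋ ℕ.+ (suc m ℕ.* suc ⌊log₂ suc m ⌋ ℕ.+ suc m)
  edges≤bound es unique all = decidable-stable (_ ℕ.≤? _) λ ≰ →
    ¬¬-∀ (λ i → ¬¬-∀ λ j → ¬¬-∀ λ k → ¬¬-→ λ i≢j → ¬¬-→ λ i≢k → ¬¬-→ λ j≢k → left-total i j k i≢j i≢k j≢k) λ total →
    ¬¬-∀ (λ i → ¬¬-∀ λ j → ¬¬-→ (apart i j)) λ separated →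
    edges≤ total separated es unique all ≰

-- The bound as a real number

toℚᵘ-/1 : ∀ a → ℚ.toℚᵘ (+ a / 1) ℚᵘ.≃ ℚᵘ.mkℚᵘ (+ a) 0
toℚᵘ-/1 a = ℚ.toℚᵘ-fromℚᵘ (ℚᵘ.mkℚᵘ (+ a) 0)

-- The fraction `+ a / 1` is normalised by a gcd and does not reduce for a variable a, so the
-- computation is made with unnormalised fractions.
/1-homo-* : ∀ a b → (+ a / 1) ℚ.* (+ b / 1) ≡ + (a ℕ.* b) / 1
/1-homo-* a b = ℚ.toℚᵘ-injective
  (ℚᵘ.≃-trans (ℚ.toℚᵘ-homo-* (+ a / 1) (+ b / 1))
  (ℚᵘ.≃-trans (ℚᵘ.*-cong (toℚᵘ-/1 a) (toℚᵘ-/1 b))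
  (ℚᵘ.≃-trans (ℚᵘ.*≡* (cong (ℤ._* + 1) (sym (ℤ.pos-* a b))))
  (ℚᵘ.≃-sym (toℚᵘ-/1 (a ℕ.* b))))))

/1-homo-+ : ∀ a b → (+ a / 1) ℚ.+ (+ b / 1) ≡ + (a ℕ.+ b) / 1
/1-homo-+ a b = ℚ.toℚᵘ-injective
  (ℚᵘ.≃-trans (ℚ.toℚᵘ-homo-+ (+ a / 1) (+ b / 1))
  (ℚᵘ.≃-trans (ℚᵘ.+-cong (toℚᵘ-/1 a) (toℚᵘ-/1 b))
  (ℚᵘ.≃-trans (ℚᵘ.*≡* (cong (ℤ._* + 1) (cong₂ ℤ._+_ (ℤ.*-identityʳ (+ a)) (ℤ.*-identityʳ (+ b)))))
  (ℚᵘ.≃-sym (toℚᵘ-/1 (a ℕ.+ b))))))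

-- Raise `2 ^ ⌊log₂ n ⌋ ≤ n` to the power k and take logarithms.
⌊log₂⌋*≤ : ∀ n .{{_ : ℕ.NonZero n}} k → ⌊log₂ n ⌋ ℕ.* k ℕ.≤ ⌊log₂ n ℕ.^ k ⌋
⌊log₂⌋*≤ n k = subst (ℕ._≤ ⌊log₂ n ℕ.^ k ⌋) (⌊log₂[2^n]⌋≡n (⌊log₂ n ⌋ ℕ.* k))
  (⌊log₂⌋-mono-≤ (subst (ℕ._≤ n ℕ.^ k) (ℕ.^-*-assoc 2 ⌊log₂ n ⌋ k) (ℕ.^-monoˡ-≤ k (2^⌊log₂⌋≤n n))))

⌊log₂⌋≤log₂-approx : ∀ n .{{_ : ℕ.NonZero n}} k → + ⌊log₂ n ⌋ / 1 ℚ.≤ log₂-approx n k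
⌊log₂⌋≤log₂-approx n k = /-mono ⌊log₂ n ⌋ 0 ⌊log₂ n ℕ.^ suc k ⌋ k
  (subst (⌊log₂ n ⌋ ℕ.* suc k ℕ.≤_) (sym (ℕ.*-identityʳ _)) (⌊log₂⌋*≤ n (suc k)))

-- The integer `⌊log₂ suc n ⌋` is below every approximant of the logarithm, so the inequality holds
-- termwise from index 0 on.
≤2nlog₂n+Cn : ∀ C n l → l ℕ.≤ 2 ℕ.* suc n ℕ.* ⌊log₂ suc n ⌋ ℕ.+ C ℕ.* suc n →
  fromℕ l ≤ fromℕ 2 * fromℕ (suc n) * log₂ (suc n) + fromℕ C * fromℕ (suc n)
≤2nlog₂n+Cn C n l l≤ ε 0<ε = 0 , λ k _ → ℚ.≤-<-trans (pointwise k)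
  (subst (ℚ._< rhs k ℚ.+ ε) (ℚ.+-identityʳ (rhs k)) (ℚ.+-monoʳ-< (rhs k) 0<ε))
  where
  N λ₀ : ℕ
  N = suc n
  λ₀ = ⌊log₂ N ⌋
  rhs : ℕ → ℚ
  rhs k = (+ 2 / 1) ℚ.* (+ N / 1) ℚ.* log₂-approx N k ℚ.+ (+ C / 1) ℚ.* (+ N / 1)
  2N≡ : (+ 2 / 1) ℚ.* (+ N / 1) ≡ + (2 ℕ.* N) / 1
  2N≡ = /1-homo-* 2 N
  main-term : ∀ k → + (2 ℕ.* N ℕ.* λ₀) / 1 ℚ.≤ (+ 2 / 1) ℚ.* (+ N / 1) ℚ.* log₂-approx N k
  main-term k = subst₂ ℚ._≤_ (/1-homo-* (2 ℕ.* N) λ₀) (cong (ℚ._* log₂-approx N k) (sym 2N≡))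
    (ℚ.*-monoˡ-≤-nonNeg (+ (2 ℕ.* N) / 1) {{ℚ.normalize-nonNeg (2 ℕ.* N) 1}} (⌊log₂⌋≤log₂-approx N k))
  pointwise : ∀ k → + l / 1 ℚ.≤ rhs k
  pointwise k = ℚ.≤-trans (/-mono l 0 (2 ℕ.* N ℕ.* λ₀ ℕ.+ C ℕ.* N) 0 (ℕ.*-monoˡ-≤ 1 l≤))
    (subst (ℚ._≤ rhs k) (/1-homo-+ (2 ℕ.* N ℕ.* λ₀) (C ℕ.* N))
      (ℚ.+-mono-≤ (main-term k) (ℚ.≤-reflexive (sym (/1-homo-* C N)))))

theorem4p3 : Σ[ C ∈ ℝ ] ((n : ℕ) → n ≥ 2 → (P : PointSet n) → ConvexlyIndependent P →
    HasAtMostEdges (unitDistanceGraph P) (fromℕ 2 * fromℕ n * log₂ n + C * fromℕ n))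
-- Each of the two factors `suc ⌊log₂ n ⌋` contributes one n to the linear term, and the longest
-- arcs contribute the third.
theorem4p3 = fromℕ 3 , λ { (suc n) _ P independent es unique edges →
  ≤2nlog₂n+Cn 3 n _ (ℕ.≤-trans (EdgeBound.edges≤bound P independent es unique edges)
    (ℕ.≤-reflexive (regroup (suc n) ⌊log₂ suc n ⌋))) }
  where
  regroup : ∀ n k → n ℕ.* suc k ℕ.+ (n ℕ.* suc k ℕ.+ n) ≡ 2 ℕ.* n ℕ.* k ℕ.+ 3 ℕ.* n
  regroup = solve-∀
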